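{- Let $n\ge 1$, let $a$ be a nonzero integer, let $f_1(X),\ldots,f_n(X)\in\mathbb{Z}[X]$ be $n$ polynomials of degrees at most $d$, and let $k_1,\ldots,k_n\ge 1$ be odd integers. For any fixed integer $r\ge 1$ there is a constant $C(r)$, depending only on $r$, such that, uniformly over all boxes $$\mathfrak{B}=[u_1+1,u_1+h]\times\cdots\times[u_n+1,u_n+h]$$ (with integers $u_1,\ldots,u_n$ and $h\ge 1$) satisfying $$\max_{i=1,\ldots,n}|u_i|\le \exp\big(C(r)h^{4/9}\big),$$ we have $$N^*_{a,\vec f,\vec k}(\mathfrak{B})\ll h^{n-4r/9},$$ provided that $$n>(d+1)(d+2)\,2^{r}\max\{2r,\;3r-9/2\}+2.$$
   Context: For $\vec f=(f_1,\ldots,f_n)$ and $\vec k=(k_1,\ldots,k_n)$, $N^*_{a,\vec f,\vec k}(\mathfrak{B})$ denotes the number of integer solutions $(x_1,\ldots,x_n)\in\mathfrak{B}$ with $x_1\cdots x_n\neq 0$ of the equation $$f_1(x_1)+\cdots+f_n(x_n)=a\,x_1^{k_1}\cdots x_n^{k_n}.$$ The notation $A\ll B$ means $|A|\le cB$ for some constant $c$; here the implied constants may depend on the degrees $\deg f_i$, the coefficient $a$, the exponents $k_i$ ($i=1,\ldots,n$), and on $r$ (but not on $h$ or the $u_i$). -}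

module Defs where

open import Data.Nat as ℕ using (ℕ; zero; suc)
open import Data.Integer as ℤ using (ℤ; +_; _+_; _*_; _^_)
open import Data.List using (List; []; _∷_; length; map; concatMap; upTo; filter)
open import Data.Vec using (Vec; []; _∷_; lookup; zipWith; foldr)
open import Data.Fin using (Fin)
open import Data.Product using (_×_)
open import Relation.Nullary using (¬_; Dec)
open import Relation.Nullary.Decidable using (_×-dec_; ¬?)
open import Relation.Binary.PropositionalEquality using (_≡_)

-- A polynomial in ℤ[X] as its list of coefficients, lowest degree first:
-- [c₀, c₁, …, c_m] represents c₀ + c₁ X + … + c_m X^m.
Poly : Set
Poly = List ℤ

eval : Poly → ℤ → ℤ
eval []       x = + 0
eval (c ∷ cs) x = c + x * eval cs x

DegLe : Poly → ℕ → Set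
DegLe p d = length p ℕ.≤ suc d

offsets : (n h : ℕ) → List (Vec ℕ n)
offsets zero    h = [] ∷ []
offsets (suc n) h = concatMap (λ j → map (j ∷_) (offsets n h)) (upTo h)

boxPoint : {n : ℕ} → Vec ℤ n → Vec ℕ n → Vec ℤ n
boxPoint u j = zipWith (λ ui ji → ui + + suc ji) u j

lhs : {n : ℕ} → Vec Poly n → Vec ℤ n → ℤ
lhs fs x = foldr _ _+_ (+ 0) (zipWith eval fs x)

monomial : {n : ℕ} → Vec ℕ n → Vec ℤ n → ℤ
monomial ks x = foldr _ _*_ (+ 1) (zipWith _^_ x ks)

AllNonzero : {n : ℕ} → Vec ℤ n → Set
AllNonzero x = ¬ (foldr _ _*_ (+ 1) x ≡ + 0)

Sol : {n : ℕ} → ℤ → Vec Poly n → Vec ℕ n → Vec ℤ n → Set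
Sol a fs ks x = AllNonzero x × (lhs fs x ≡ a * monomial ks x)

Sol? : {n : ℕ} (a : ℤ) (fs : Vec Poly n) (ks : Vec ℕ n) (x : Vec ℤ n) → Dec (Sol a fs ks x)
Sol? a fs ks x = ¬? (foldr _ _*_ (+ 1) x ℤ.≟ + 0) ×-dec (lhs fs x ℤ.≟ a * monomial ks x)

Nstar : {n : ℕ} → ℤ → Vec Poly n → Vec ℕ n → Vec ℤ n → ℕ → ℕ
Nstar {n} a fs ks u h =
  length (filter (λ j → Sol? a fs ks (boxPoint u j)) (offsets n h))

{-# OPTIONS --safe #-}
-- Split the variables as x = (y , z , w) with y and z of length r, and fix w. The equation becomes
-- F(y) + G(z) = a′ p(y) q(z) with monomials p and q, and two values p(y) ≢ p(y′) determine q(z),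
-- as two lines meet in one point. By Cauchy–Schwarz the number N of pairs (y , z) satisfies
-- N² ≤ 2 T h^{3r}, where T bounds the number of points of a box of dimension r on which a monomial
-- takes a given nonzero value Q. So a bound T ≪ h^{r/9} gives N ≪ h^{14r/9} = h^{2r − 4r/9}.
--
-- Let A be the size of the largest coordinates occurring in that box and K the degree of the monomial.
-- On a solution the corresponding coordinate divides Q, and |Q| ≤ A^K.
-- If A is larger than a certain power of h, then Q has at most K divisors in an interval of length h,
-- since the product of K + 1 divisors divides Q times the product of their differences. Otherwise Q is
-- at most a power of h, and the divisor bound applies. In both cases the coordinate takes ≪ h^{1/9}
-- values, and T is bounded by induction on the dimension.

module Submission where

open import Defs
open import Algebra.Properties.CommutativeSemigroup using (interchange; x∙yz≈y∙xz)
open import Data.Nat as ℕ using (ℕ; zero; suc; _+_; _*_; _^_; _≤_; _<_; _∸_; _⊔_; _%_; _/_; z≤n; s≤s; NonZero; NonTrivial; >-nonZero; >-nonZero⁻¹)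
open import Data.Nat.Properties
open import Data.Nat.Divisibility as ℕ using (_∣?_; ∣⇒≤; ∣1⇒≡1; divides; quotient; quotient≢0; quotient-<; m∣n⇒n≡m*quotient; ∣m⇒∣m*n; m∣m*n; n∣m*n; *-cancelʳ-∣)
open import Data.Nat.DivMod using (m≡m%n+[m/n]*n; m%n<n)
open import Data.Nat.Induction using (<-wellFounded; Acc; acc)
open import Data.Nat.ListAction using (sum; product)
open import Data.Nat.ListAction.Properties using (sum-++)
open import Data.Nat.Primality using (Prime; _Rough_; prime⇒irreducible; prime⇒nonZero; prime⇒nonTrivial; rough⇒≤; rough∧∣⇒rough; rough∧∣⇒prime; ∤⇒rough-suc; 0-rough; 1-rough; 2-rough)
open import Data.Nat.Primality.Factorisation using (factorise; module PrimeFactorisation)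
open import Data.Nat.Coprimality using (Coprime; coprime-divisor)
open import Data.Nat.Tactic.RingSolver using (solve-∀)
open import Data.Integer as ℤ using (ℤ; ∣_∣)
import Data.Integer.Properties as ℤ
import Data.Integer.Divisibility.Signed as ℤ
import Data.Integer.Tactic.RingSolver as ℤ
open import Data.Fin using (Fin; zero; suc)
open import Data.List as List using (List; []; _∷_; length; map; filter; foldr; take; concatMap; upTo)
open import Data.List.Properties using (length-map; length-take; length-upTo; map-cong; map-∘; map-++)
open import Data.List.Relation.Unary.All as All using (All; []; _∷_)
import Data.List.Relation.Unary.All.Properties as All
open import Data.List.Relation.Unary.AllPairs using ([]; _∷_)
open import Data.List.Relation.Unary.Unique.Propositional using (Unique)
import Data.List.Relation.Unary.Unique.Propositional.Properties as Unique
open import Data.Product using (Σ; ∃-syntax; _×_; _,_; proj₁; proj₂)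
open import Data.Sum using (_⊎_; inj₁; inj₂)
open import Data.Vec as Vec using (Vec; []; _∷_; _++_; insertAt; zipWith; lookup)
open import Data.Vec.Properties using (insertAt-removeAt)
open import Data.Vec.Relation.Unary.All as VecAll using ([]; _∷_) renaming (All to VecAll)
import Data.Vec.Relation.Unary.All.Properties as VecAll
open import Function using (_∘_)
open import Level using (0ℓ)
open import Relation.Nullary using (¬_; Dec; yes; no; contradiction)
open import Relation.Nullary.Decidable using (¬?)
open import Relation.Unary using (Pred; Decidable)
open import Relation.Binary.PropositionalEquality

-- Powers and integer roots.

^-distribʳ-* : ∀ k m n → (m * n) ^ k ≡ m ^ k * n ^ k
^-distribʳ-* zero    m n = refl
^-distribʳ-* (suc k) m n = begin
  m * n * (m * n) ^ k         ≡⟨ cong (m * n *_) (^-distribʳ-* k m n) ⟩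
  m * n * (m ^ k * n ^ k)     ≡⟨ [m*n]*[o*p]≡[m*o]*[n*p] m n (m ^ k) (n ^ k) ⟩
  m * m ^ k * (n * n ^ k)     ∎
  where open ≡-Reasoning

^-cancelʳ-≤ : ∀ k .{{_ : NonZero k}} {m n} → m ^ k ≤ n ^ k → m ≤ n
^-cancelʳ-≤ k mᵏ≤nᵏ = ≮⇒≥ λ n<m → <⇒≱ (^-monoˡ-< k n<m) mᵏ≤nᵏ

m≤m^k : ∀ m k .{{_ : NonZero k}} → m ≤ m ^ k
m≤m^k zero    k       = z≤n
m≤m^k (suc m) (suc k) = m≤m*n (suc m) (suc m ^ k) {{m^n≢0 (suc m) k}}

abstract
  -- The integer part of the `k`-th root of `X`. Bounds with ninth roots are carried as `t ^ 9 ≤ X`;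
  -- taking the root turns such a bound into one number that bounds every term of a sum.
  root : ∀ k .{{_ : NonZero k}} X → ∃[ T ] T ^ k ≤ X × (∀ {y} → y ^ k ≤ X → y ≤ T)
  root k@(suc _) X = search X (λ yᵏ≤X → ≤-trans (m≤m^k _ k) yᵏ≤X)
    where
    search : ∀ T → (∀ {y} → y ^ k ≤ X → y ≤ T) → ∃[ T ] T ^ k ≤ X × (∀ {y} → y ^ k ≤ X → y ≤ T)
    search T max with T ^ k ≤? X
    ... | yes Tᵏ≤X = T , Tᵏ≤X , max
    search zero    max | no 0ᵏ≰X = contradiction z≤n 0ᵏ≰X
    search (suc T) max | no Tᵏ≰X = search T λ {y} yᵏ≤X →
      ≤-pred (≤∧≢⇒< (max yᵏ≤X) λ { refl → Tᵏ≰X yᵏ≤X })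

-- Cardinality bounds for predicates.

module _ {A : Set} where

  -- A bound on the cardinality of `P` through duplicate-free lists, so that no enumeration of `P`
  -- has to be given.
  AtMost : Pred A 0ℓ → ℕ → Set
  AtMost P t = ∀ xs → Unique xs → All P xs → length xs ≤ t

  length-filter-∁ : ∀ {P : Pred A 0ℓ} (P? : Decidable P) xs →
    length xs ≡ length (filter P? xs) + length (filter (¬? ∘ P?) xs)
  length-filter-∁ P? []       = refl
  length-filter-∁ P? (x ∷ xs) with P? x
  ... | yes _ = cong suc (length-filter-∁ P? xs)
  ... | no _  = trans (cong suc (length-filter-∁ P? xs)) (sym (+-suc _ _))

  AtMost-split : ∀ {P R : Pred A 0ℓ} (R? : Decidable R) {s t} →
    AtMost (λ x → P x × R x) s → AtMost (λ x → P x × ¬ R x) t → AtMost P (s + t)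
  AtMost-split R? {s} {t} boundR bound¬R xs !xs Pxs = begin
    length xs                                              ≡⟨ length-filter-∁ R? xs ⟩
    length (filter R? xs) + length (filter (¬? ∘ R?) xs)   ≤⟨ +-mono-≤
      (boundR _ (Unique.filter⁺ R? !xs) (All.zip (All.filter⁺ R? Pxs , All.all-filter R? xs)))
      (bound¬R _ (Unique.filter⁺ (¬? ∘ R?) !xs) (All.zip (All.filter⁺ (¬? ∘ R?) Pxs , All.all-filter (¬? ∘ R?) xs))) ⟩
    s + t                                                  ∎
    where open ≤-Reasoning

  AtMost-≡ : ∀ a → AtMost (_≡ a) 1
  AtMost-≡ a []           _                 _                   = z≤n
  AtMost-≡ a (_ ∷ [])     _                 _                   = ≤-refl
  AtMost-≡ a (_ ∷ _ ∷ _)  ((x≢y ∷ _) ∷ _)   (refl ∷ refl ∷ _)   = contradiction refl x≢y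

-- Elements of `P` are lifted along `g`. Lifts of distinct elements are distinct because `g` is a
-- function, so a duplicate-free list in `P` yields one of the same length in `Q`.
AtMost-image : ∀ {A B : Set} {P : Pred A 0ℓ} {Q : Pred B 0ℓ} (g : B → A) →
  (∀ {x} → P x → ∃[ y ] x ≡ g y × Q y) → ∀ {t} → AtMost Q t → AtMost P t
AtMost-image {P = P} {Q} g lift bound xs !xs Pxs with preimages Pxs
  where
  preimages : ∀ {xs} → All P xs → ∃[ ys ] xs ≡ map g ys × All Q ys
  preimages []         = [] , refl , []
  preimages (Px ∷ Pxs) with lift Px | preimages Pxs
  ... | y , refl , Qy | ys , refl , Qys = y ∷ ys , refl , Qy ∷ Qys
... | ys , refl , Qys = ≤-trans (≤-reflexive (length-map g ys)) (bound ys (Unique.map⁻ !xs) Qys)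

AtMost-⊆ : ∀ {A : Set} {P Q : Pred A 0ℓ} → (∀ {x} → P x → Q x) → ∀ {t} → AtMost Q t → AtMost P t
AtMost-⊆ P⊆Q bound xs !xs Pxs = bound xs !xs (All.map P⊆Q Pxs)

-- The divisor bound.

DivisorsOf : ℕ → Pred ℤ 0ℓ
DivisorsOf q x = ∣ x ∣ ℕ.∣ q

-- Divisors of either sign are counted, since the coordinates of a box may be negative; hence 2 and
-- not 1.
divisorsOf-1 : AtMost (DivisorsOf 1) 2
divisorsOf-1 = AtMost-split (ℤ._≟ ℤ.+ 1)
  (AtMost-⊆ proj₂ (AtMost-≡ (ℤ.+ 1)))
  (AtMost-⊆ minusOne (AtMost-≡ (ℤ.- ℤ.+ 1)))
  where
  minusOne : ∀ {x} → DivisorsOf 1 x × ¬ (x ≡ ℤ.+ 1) → x ≡ ℤ.- ℤ.+ 1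
  minusOne {ℤ.+ n}     (x∣1 , x≢1) = contradiction (cong ℤ.+_ (∣1⇒≡1 x∣1)) x≢1
  minusOne {ℤ.-[1+ n ]} (x∣1 , _)   = cong ℤ.-[1+_] (suc-injective (∣1⇒≡1 x∣1))

prime∤⇒coprime : ∀ {p x} → Prime p → ¬ (p ℕ.∣ x) → Coprime x p
prime∤⇒coprime pr p∤x (d∣x , d∣p) with prime⇒irreducible pr d∣p
... | inj₁ d≡1  = d≡1
... | inj₂ refl = contradiction d∣x p∤x

∤prime-cancel : ∀ {p x} → Prime p → ¬ (p ℕ.∣ x) → ∀ e {m} → x ℕ.∣ p ^ e * m → x ℕ.∣ m
∤prime-cancel         pr p∤x zero    {m} x∣ = subst (_ ℕ.∣_) (*-identityˡ m) x∣
∤prime-cancel {p} {x} pr p∤x (suc e) {m} x∣ = ∤prime-cancel pr p∤x e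
  (coprime-divisor (prime∤⇒coprime pr p∤x) (subst (x ℕ.∣_) (*-assoc p (p ^ e) m) x∣))

-- Induction on `e`: a divisor prime to `p` divides `m`, and any other is `p` times a divisor of the
-- number with one factor `p` less. Each further factor `p` thus adds at most `t` divisors.
divisorsOf-p^e*m : ∀ {p m t} → Prime p → AtMost (DivisorsOf m) t →
  ∀ e → AtMost (DivisorsOf (p ^ e * m)) (suc e * t)
divisorsOf-p^e*m {p} {m} {t} pr bound zero =
  subst₂ (λ q s → AtMost (DivisorsOf q) s) (sym (*-identityˡ m)) (sym (*-identityˡ t)) bound
divisorsOf-p^e*m {p} {m} {t} pr bound (suc e) =
  subst (AtMost (DivisorsOf (p ^ suc e * m))) (+-comm (suc e * t) t)
    (AtMost-split (λ x → p ∣? ∣ x ∣)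
      (AtMost-image (ℤ._* ℤ.+ p) divide (divisorsOf-p^e*m pr bound e))
      (AtMost-⊆ (λ { {x} (x∣ , p∤x) → ∤prime-cancel pr p∤x (suc e) x∣ }) bound))
  where
  instance _ = prime⇒nonZero pr
  divide : ∀ {x} → DivisorsOf (p ^ suc e * m) x × (p ℕ.∣ ∣ x ∣) →
    ∃[ y ] x ≡ y ℤ.* ℤ.+ p × DivisorsOf (p ^ e * m) y
  divide {x} (x∣ , p∣x) with ℤ.∣ᵤ⇒∣ {ℤ.+ p} {x} p∣x
  ... | ℤ.divides y x≡y*p = y , x≡y*p ,
    *-cancelʳ-∣ p (subst₂ ℕ._∣_ (trans (cong ∣_∣ x≡y*p) (ℤ.abs-* y (ℤ.+ p))) p*p^e*m x∣)
    where
    p*p^e*m : p * p ^ e * m ≡ p ^ e * m * p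
    p*p^e*m = trans (*-assoc p (p ^ e) m) (*-comm p (p ^ e * m))

-- Writing e = s a + b with b < s, we have 1 + e ≤ s (1 + a) ≤ s 2^a.
[1+e]^s≤s^s*2^e : ∀ s .{{_ : NonZero s}} e → suc e ^ s ≤ s ^ s * 2 ^ e
[1+e]^s≤s^s*2^e s e = begin
  suc e ^ s               ≤⟨ ^-monoˡ-≤ s 1+e≤s*2^a ⟩
  (s * 2 ^ a) ^ s         ≡⟨ ^-distribʳ-* s s (2 ^ a) ⟩
  s ^ s * (2 ^ a) ^ s     ≡⟨ cong (s ^ s *_) (^-*-assoc 2 a s) ⟩
  s ^ s * 2 ^ (a * s)     ≤⟨ *-monoʳ-≤ (s ^ s) (^-monoʳ-≤ 2 (≤-trans (m≤n+m (a * s) (e % s)) (≤-reflexive (sym e≡)))) ⟩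
  s ^ s * 2 ^ e           ∎
  where
  open ≤-Reasoning
  a : ℕ
  a = e / s
  e≡ : e ≡ e % s + a * s
  e≡ = m≡m%n+[m/n]*n e s
  1+m≤2^m : ∀ m → suc m ≤ 2 ^ m
  1+m≤2^m zero    = ≤-refl
  1+m≤2^m (suc m) = begin
    suc (suc m)    ≤⟨ +-mono-≤ (m^n>0 2 m) (1+m≤2^m m) ⟩
    2 ^ m + 2 ^ m  ≡⟨ cong (2 ^ m +_) (+-identityʳ (2 ^ m)) ⟨
    2 ^ suc m      ∎
  1+e≤s*2^a : suc e ≤ s * 2 ^ a
  1+e≤s*2^a = begin
    suc e                ≡⟨ cong suc e≡ ⟩
    suc (e % s) + a * s  ≤⟨ +-monoˡ-≤ (a * s) (m%n<n e s) ⟩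
    s + a * s            ≡⟨ *-comm (suc a) s ⟩
    s * suc a            ≤⟨ *-monoʳ-≤ s (1+m≤2^m a) ⟩
    s * 2 ^ a            ∎

extractPower : ∀ k → .{{NonTrivial k}} → ∀ q .{{_ : NonZero q}} → ∃[ e ] ∃[ m ] q ≡ k ^ e * m × ¬ (k ℕ.∣ m)
extractPower k q = go q (<-wellFounded q)
  where
  go : ∀ q .{{_ : NonZero q}} → Acc _<_ q → ∃[ e ] ∃[ m ] q ≡ k ^ e * m × ¬ (k ℕ.∣ m)
  go q (acc rec) with k ∣? q
  ... | no k∤q = 0 , q , sym (*-identityˡ q) , k∤q
  ... | yes k∣q with go (quotient k∣q) {{quotient≢0 k∣q}} (rec (quotient-< k∣q))
  ...   | e , m , eq , k∤m = suc e , m , trans (m∣n⇒n≡m*quotient k∣q) (trans (cong (k *_) eq) (sym (*-assoc k (k ^ e) m))) , k∤m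

-- The estimate d(q) ≪ q^ε with ε = 1/s, free of fractional exponents.
HasDivisorBound : ℕ → ℕ → ℕ → Set
HasDivisorBound s C q = ∃[ t ] AtMost (DivisorsOf q) t × t ^ s ≤ C * q

-- Each prime factor `p` at most doubles the number of divisors. This multiplies `t ^ s` by 2^s,
-- which is at most `p` by roughness.
roughDivisorBound : ∀ s q .{{_ : NonZero q}} → (2 ^ s) Rough q → HasDivisorBound s (2 ^ s) q
roughDivisorBound s q rough = subst (HasDivisorBound s (2 ^ s)) (sym isFactorisation)
  (bound factors factorsPrime (subst ((2 ^ s) Rough_) isFactorisation rough))
  where
  open PrimeFactorisation (factorise q)
  bound : ∀ ps → All Prime ps → (2 ^ s) Rough (product ps) → HasDivisorBound s (2 ^ s) (product ps)
  bound []       _          _     = 2 , divisorsOf-1 , ≤-reflexive (sym (*-identityʳ (2 ^ s)))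
  bound (p ∷ ps) (pr ∷ prs) rough with bound ps prs (rough∧∣⇒rough rough (n∣m*n p))
  ... | t , atMost , tˢ≤ =
    2 * t ,
    subst (λ q → AtMost (DivisorsOf (q * product ps)) (2 * t)) (*-identityʳ p) (divisorsOf-p^e*m pr atMost 1) ,
    (begin
      (2 * t) ^ s                  ≡⟨ ^-distribʳ-* s 2 t ⟩
      2 ^ s * t ^ s                ≤⟨ *-mono-≤ 2ˢ≤p tˢ≤ ⟩
      p * (2 ^ s * product ps)     ≡⟨ x∙yz≈y∙xz *-commutativeSemigroup p (2 ^ s) (product ps) ⟩
      2 ^ s * (p * product ps)     ∎)
    where
    open ≤-Reasoning
    instance _ = prime⇒nonTrivial pr
    2ˢ≤p : 2 ^ s ≤ p
    2ˢ≤p = rough⇒≤ (rough∧∣⇒rough rough (m∣m*n (product ps)))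

divisorBound : ∀ s .{{_ : NonZero s}} → ∃[ C ] ∀ q .{{_ : NonZero q}} → HasDivisorBound s C q
divisorBound s = proj₁ all , λ q → proj₂ all q 0-rough
  where
  -- Descending induction on the roughness bound `B`, at distance `j` from 2^s. The start is
  -- `roughDivisorBound`. Passing from `suc B` to `B` admits an extra factor `B ^ e`, which
  -- multiplies the number of divisors by at most 1 + e and so the constant by s^s.
  descend : ∀ j B → B + j ≡ 2 ^ s → ∃[ C ] ∀ q .{{_ : NonZero q}} → B Rough q → HasDivisorBound s C q
  descend zero B B≡2ˢ = 2 ^ s , λ q rough →
    roughDivisorBound s q (subst (_Rough q) (trans (sym (+-identityʳ B)) B≡2ˢ) rough)
  descend (suc j) B B+1+j≡2ˢ with descend j (suc B) (trans (sym (+-suc B j)) B+1+j≡2ˢ)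
  -- Every number is 1-rough and 2-rough, so the constant is kept for `B` equal to 0 and 1.
  descend (suc j) 0 _ | C , bound = C , λ q _ → bound q 1-rough
  descend (suc j) 1 _ | C , bound = C , λ q _ → bound q 2-rough
  descend (suc j) B@(suc (suc _)) _ | C , bound = s ^ s * C , step
    where
    step : ∀ q .{{_ : NonZero q}} → B Rough q → HasDivisorBound s (s ^ s * C) q
    step q rough with extractPower B q
    ... | e , m , refl , B∤m = suc e * t , atMost e rough ,
      (begin
        (suc e * t) ^ s           ≡⟨ ^-distribʳ-* s (suc e) t ⟩
        suc e ^ s * t ^ s         ≤⟨ *-mono-≤ 1+eˢ≤ tˢ≤ ⟩
        s ^ s * B ^ e * (C * m)   ≡⟨ [m*n]*[o*p]≡[m*o]*[n*p] (s ^ s) (B ^ e) C m ⟩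
        s ^ s * C * (B ^ e * m)   ∎)
      where
      open ≤-Reasoning
      boundₘ : HasDivisorBound s C m
      boundₘ = bound m {{m*n≢0⇒n≢0 (B ^ e)}} (∤⇒rough-suc B∤m (rough∧∣⇒rough rough (n∣m*n (B ^ e))))
      t = proj₁ boundₘ
      tˢ≤ = proj₂ (proj₂ boundₘ)
      1+eˢ≤ : suc e ^ s ≤ s ^ s * B ^ e
      1+eˢ≤ = ≤-trans ([1+e]^s≤s^s*2^e s e) (*-monoʳ-≤ (s ^ s) (^-monoˡ-≤ e (s≤s (s≤s z≤n))))
      -- No primality test for `B` is made: if the exponent is positive, then `B` divides a
      -- `B`-rough number and is therefore prime.
      atMost : ∀ e → B Rough (B ^ e * m) → AtMost (DivisorsOf (B ^ e * m)) (suc e * t)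
      atMost zero _ = subst₂ (λ q t → AtMost (DivisorsOf q) t)
        (sym (*-identityˡ m)) (sym (*-identityˡ t)) (proj₁ (proj₂ boundₘ))
      atMost (suc e) rough = divisorsOf-p^e*m
        (rough∧∣⇒prime rough (∣m⇒∣m*n m (m∣m*n (B ^ e)))) (proj₁ (proj₂ boundₘ)) (suc e)
  all : ∃[ C ] ∀ q .{{_ : NonZero q}} → 0 Rough q → HasDivisorBound s C q
  all = descend (2 ^ s) 0 refl

-- Divisors in a short interval.

∏ : List ℤ → ℤ
∏ = foldr ℤ._*_ (ℤ.+ 1)

∏-differences : ℤ → List ℤ → ℤ
∏-differences x ys = ∏ (map (λ y → x ℤ.- y) ys)

vandermonde : List ℤ → ℤ
vandermonde []       = ℤ.+ 1
vandermonde (x ∷ xs) = ∏-differences x xs ℤ.* vandermonde xs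

-- In the inductive step the claims for x ∷ xs and y ∷ xs are combined through (x − y) = x · 1 − y · 1.
∏∣q*vandermonde : ∀ {q} x xs → All (ℤ._∣ q) (x ∷ xs) → ∏ (x ∷ xs) ℤ.∣ q ℤ.* vandermonde (x ∷ xs)
∏∣q*vandermonde {q} x [] (x∣q ∷ []) = subst₂ ℤ._∣_ (sym (ℤ.*-identityʳ x)) (sym (ℤ.*-identityʳ q)) x∣q
∏∣q*vandermonde {q} x (y ∷ ys) (x∣q ∷ y∣q ∷ ys∣q)
  with ∏∣q*vandermonde x ys (x∣q ∷ ys∣q) | ∏∣q*vandermonde y ys (y∣q ∷ ys∣q)
... | ℤ.divides c qδΔ≡cxP | ℤ.divides d qεΔ≡dyP = ℤ.divides (δ ℤ.* d ℤ.- ε ℤ.* c) (begin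
  q ℤ.* ((x ℤ.- y) ℤ.* δ ℤ.* (ε ℤ.* Δ))                                      ≡⟨ expand q x y δ ε Δ ⟩
  x ℤ.* δ ℤ.* (q ℤ.* (ε ℤ.* Δ)) ℤ.- y ℤ.* ε ℤ.* (q ℤ.* (δ ℤ.* Δ))            ≡⟨ cong₂ (λ a b → x ℤ.* δ ℤ.* a ℤ.- y ℤ.* ε ℤ.* b) qεΔ≡dyP qδΔ≡cxP ⟩
  x ℤ.* δ ℤ.* (d ℤ.* (y ℤ.* P)) ℤ.- y ℤ.* ε ℤ.* (c ℤ.* (x ℤ.* P))            ≡⟨ collect x y δ ε c d P ⟩
  (δ ℤ.* d ℤ.- ε ℤ.* c) ℤ.* (x ℤ.* (y ℤ.* P))                                ∎)
  where
  open ≡-Reasoning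
  δ = ∏-differences x ys
  ε = ∏-differences y ys
  Δ = vandermonde ys
  P = ∏ ys
  expand : ∀ q x y δ ε Δ → q ℤ.* ((x ℤ.- y) ℤ.* δ ℤ.* (ε ℤ.* Δ)) ≡
    x ℤ.* δ ℤ.* (q ℤ.* (ε ℤ.* Δ)) ℤ.- y ℤ.* ε ℤ.* (q ℤ.* (δ ℤ.* Δ))
  expand = ℤ.solve-∀
  collect : ∀ x y δ ε c d P → x ℤ.* δ ℤ.* (d ℤ.* (y ℤ.* P)) ℤ.- y ℤ.* ε ℤ.* (c ℤ.* (x ℤ.* P)) ≡
    (δ ℤ.* d ℤ.- ε ℤ.* c) ℤ.* (x ℤ.* (y ℤ.* P))
  collect = ℤ.solve-∀

InInterval : ℤ → ℕ → Pred ℤ 0ℓ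
InInterval u h x = ∃[ j ] j < h × x ≡ u ℤ.+ ℤ.+ suc j

interval-difference : ∀ {u h x y} → InInterval u h x → InInterval u h y → ∣ x ℤ.- y ∣ ≤ h
interval-difference {u} {h} (i , i<h , refl) (j , j<h , refl) = begin
  ∣ u ℤ.+ ℤ.+ suc i ℤ.- (u ℤ.+ ℤ.+ suc j) ∣ ≡⟨ cong ∣_∣ (cancel u (ℤ.+ suc i) (ℤ.+ suc j)) ⟩
  ∣ ℤ.+ suc i ℤ.- ℤ.+ suc j ∣               ≡⟨ cong ∣_∣ (ℤ.m-n≡m⊖n (suc i) (suc j)) ⟩
  ∣ suc i ℤ.⊖ suc j ∣                       ≤⟨ ℤ.∣m⊝n∣≤m⊔n (suc i) (suc j) ⟩
  suc i ⊔ suc j                             ≤⟨ ⊔-lub i<h j<h ⟩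
  h                                         ∎
  where
  open ≤-Reasoning
  cancel : ∀ u a b → u ℤ.+ a ℤ.- (u ℤ.+ b) ≡ a ℤ.- b
  cancel = ℤ.solve-∀

∏-differences-≤ : ∀ {u h x} ys → InInterval u h x → All (InInterval u h) ys →
  ∣ ∏-differences x ys ∣ ≤ h ^ length ys
∏-differences-≤             []       _  _          = ≤-refl
∏-differences-≤ {u} {h} {x} (y ∷ ys) x∈ (y∈ ∷ ys∈) = begin
  ∣ (x ℤ.- y) ℤ.* ∏-differences x ys ∣    ≡⟨ ℤ.abs-* (x ℤ.- y) _ ⟩
  ∣ x ℤ.- y ∣ * ∣ ∏-differences x ys ∣    ≤⟨ *-mono-≤ (interval-difference {u} x∈ y∈) (∏-differences-≤ {u} ys x∈ ys∈) ⟩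
  h * h ^ length ys                       ∎
  where open ≤-Reasoning

-- Every difference is at most `h`. The exponent is the square of the length, a generous bound for
-- the number of pairs.
vandermonde-≤ : ∀ {u h} .{{_ : NonZero h}} xs → All (InInterval u h) xs →
  ∣ vandermonde xs ∣ ≤ h ^ (length xs * length xs)
vandermonde-≤         []       _          = ≤-refl
vandermonde-≤ {u} {h} (x ∷ xs) (x∈ ∷ xs∈) = begin
  ∣ ∏-differences x xs ℤ.* vandermonde xs ∣       ≡⟨ ℤ.abs-* (∏-differences x xs) _ ⟩
  ∣ ∏-differences x xs ∣ * ∣ vandermonde xs ∣     ≤⟨ *-mono-≤ (∏-differences-≤ {u} xs x∈ xs∈) (vandermonde-≤ {u} xs xs∈) ⟩
  h ^ l * h ^ (l * l)                             ≡⟨ ^-distribˡ-+-* h l (l * l) ⟨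
  h ^ (l + l * l)                                 ≤⟨ ^-monoʳ-≤ h (≤-trans (*-monoʳ-≤ (suc l) (n≤1+n l)) ≤-refl) ⟩
  h ^ (suc l * suc l)                             ∎
  where
  open ≤-Reasoning
  l = length xs

*-≢0 : ∀ {i j} → i ≢ ℤ.+ 0 → j ≢ ℤ.+ 0 → i ℤ.* j ≢ ℤ.+ 0
*-≢0 {i} i≢0 j≢0 ij≡0 with ℤ.i*j≡0⇒i≡0∨j≡0 i ij≡0
... | inj₁ i≡0 = i≢0 i≡0
... | inj₂ j≡0 = j≢0 j≡0

∏-differences-≢0 : ∀ {x} ys → All (x ≢_) ys → ∏-differences x ys ≢ ℤ.+ 0
∏-differences-≢0     []       _            = λ ()
∏-differences-≢0 {x} (y ∷ ys) (x≢y ∷ x≢ys) = *-≢0 (x≢y ∘ ℤ.i-j≡0⇒i≡j x y) (∏-differences-≢0 ys x≢ys)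

vandermonde-≢0 : ∀ xs → Unique xs → vandermonde xs ≢ ℤ.+ 0
vandermonde-≢0 []       _            = λ ()
vandermonde-≢0 (x ∷ xs) (x≢xs ∷ !xs) = *-≢0 (∏-differences-≢0 xs x≢xs) (vandermonde-≢0 xs !xs)

∏-≥ : ∀ {A} xs → All (λ x → A ≤ 3 * ∣ x ∣) xs → A ^ length xs ≤ 3 ^ length xs * ∣ ∏ xs ∣
∏-≥     []       _            = ≤-refl
∏-≥ {A} (x ∷ xs) (A≤3x ∷ A≤3xs) = begin
  A * A ^ length xs                          ≤⟨ *-mono-≤ A≤3x (∏-≥ xs A≤3xs) ⟩
  3 * ∣ x ∣ * (3 ^ length xs * ∣ ∏ xs ∣)     ≡⟨ [m*n]*[o*p]≡[m*o]*[n*p] 3 ∣x∣ (3 ^ length xs) ∣∏xs∣ ⟩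
  3 * 3 ^ length xs * (∣ x ∣ * ∣ ∏ xs ∣)     ≡⟨ cong (3 * 3 ^ length xs *_) (ℤ.abs-* x (∏ xs)) ⟨
  3 * 3 ^ length xs * ∣ x ℤ.* ∏ xs ∣         ∎
  where
  open ≤-Reasoning
  ∣x∣ = ∣ x ∣
  ∣∏xs∣ = ∣ ∏ xs ∣

-- The product of K + 1 divisors is at least (A/3)^(K+1). It divides q times the Vandermonde
-- product, which is nonzero as the divisors are distinct, so it is at most A^K h^((K+1)²).
-- Cancelling A^K leaves the bound for A.
manyDivisors⇒A-small : ∀ {u h A K q} .{{_ : NonZero h}} .{{_ : NonZero A}} .{{_ : NonZero q}} → q ≤ A ^ K →
  ∀ x xs → length xs ≡ K → Unique (x ∷ xs) → All (DivisorsOf q) (x ∷ xs) → All (InInterval u h) (x ∷ xs) →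
  All (λ x → A ≤ 3 * ∣ x ∣) (x ∷ xs) → A ≤ 3 ^ suc K * h ^ (suc K * suc K)
manyDivisors⇒A-small {u} {h} {A} {K} {suc q-1} q≤A^K x xs refl !xs xs∣q xs∈ A≤3xs =
  *-cancelʳ-≤ A _ (A ^ K) {{m^n≢0 A K}} (begin
    A ^ S                                    ≤⟨ ∏-≥ (x ∷ xs) A≤3xs ⟩
    3 ^ S * ∣ ∏ (x ∷ xs) ∣                   ≤⟨ *-monoʳ-≤ (3 ^ S) ∏≤ ⟩
    3 ^ S * (q * ∣ Δ ∣)                      ≤⟨ *-monoʳ-≤ (3 ^ S) (*-mono-≤ q≤A^K (vandermonde-≤ {u} (x ∷ xs) xs∈)) ⟩
    3 ^ S * (A ^ K * h ^ (S * S))            ≡⟨ cong (3 ^ S *_) (*-comm (A ^ K) _) ⟩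
    3 ^ S * (h ^ (S * S) * A ^ K)            ≡⟨ *-assoc (3 ^ S) _ _ ⟨
    3 ^ S * h ^ (S * S) * A ^ K              ∎)
  where
  open ≤-Reasoning
  S = suc K
  q = suc q-1
  Δ = vandermonde (x ∷ xs)
  ∏≤ : ∣ ∏ (x ∷ xs) ∣ ≤ q * ∣ Δ ∣
  ∏≤ = subst (∣ ∏ (x ∷ xs) ∣ ≤_) (ℤ.abs-* (ℤ.+ q) Δ)
    (∣⇒≤ {{ℤ.≢-nonZero (*-≢0 {ℤ.+ q} (λ ()) (vandermonde-≢0 (x ∷ xs) !xs))}}
      (ℤ.∣⇒∣ᵤ (∏∣q*vandermonde {ℤ.+ q} x xs (All.map ℤ.∣ᵤ⇒∣ xs∣q))))

take-suc : ∀ {A : Set} K (xs : List A) → K < length xs → ∃[ y ] ∃[ ys ] take (suc K) xs ≡ y ∷ ys × length ys ≡ K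
take-suc K (x ∷ xs) (s≤s K≤l) = x , take K xs , refl , trans (length-take K xs) (m≤n⇒m⊓n≡m K≤l)

-- The hypothesis says 2h ≤ |u|. As |x| ≥ |u| - h, this gives |x| ≥ h, and then |u| + h ≤ |x| + 2h ≤
-- 3|x|.
interval-comparable : ∀ {u h x} → 3 * h ≤ ∣ u ∣ + h → InInterval u h x → ∣ u ∣ + h ≤ 3 * ∣ x ∣
interval-comparable {u} {h} {x} 3h≤ (j , j<h , x≡) = begin
  ∣ u ∣ + h                ≤⟨ +-monoˡ-≤ h u≤ ⟩
  ∣ x ∣ + h + h            ≤⟨ +-mono-≤ (+-monoʳ-≤ ∣ x ∣ h≤) h≤ ⟩
  ∣ x ∣ + ∣ x ∣ + ∣ x ∣    ≡⟨ 3x ∣ x ∣ ⟩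
  3 * ∣ x ∣                ∎
  where
  open ≤-Reasoning
  3x : ∀ m → m + m + m ≡ 3 * m
  3x m = trans (+-assoc m m m) (cong (λ n → m + (m + n)) (sym (+-identityʳ m)))
  minus : ∀ u a → u ≡ u ℤ.+ a ℤ.- a
  minus = ℤ.solve-∀
  u≤ : ∣ u ∣ ≤ ∣ x ∣ + h
  u≤ = begin
    ∣ u ∣                            ≡⟨ cong ∣_∣ (trans (minus u (ℤ.+ suc j)) (cong (ℤ._- ℤ.+ suc j) (sym x≡))) ⟩
    ∣ x ℤ.- ℤ.+ suc j ∣              ≤⟨ ℤ.∣i-j∣≤∣i∣+∣j∣ x (ℤ.+ suc j) ⟩
    ∣ x ∣ + suc j                    ≤⟨ +-monoʳ-≤ ∣ x ∣ j<h ⟩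
    ∣ x ∣ + h                        ∎
  h≤ : h ≤ ∣ x ∣
  h≤ = +-cancelʳ-≤ (h + h) h ∣ x ∣ (begin
    h + (h + h)         ≡⟨ trans (sym (+-assoc h h h)) (3x h) ⟩
    3 * h               ≤⟨ 3h≤ ⟩
    ∣ u ∣ + h           ≤⟨ +-monoˡ-≤ h u≤ ⟩
    ∣ x ∣ + h + h       ≡⟨ +-assoc ∣ x ∣ h h ⟩
    ∣ x ∣ + (h + h)     ∎)

-- Otherwise the first K + 1 of the divisors contradict `manyDivisors⇒A-small`. The largeness of |u|
-- + h also supplies the condition of `interval-comparable`.
fewDivisors : ∀ {u h K q} .{{_ : NonZero h}} .{{_ : NonZero q}} → q ≤ (∣ u ∣ + h) ^ K →
  3 ^ suc K * h ^ (suc K * suc K) < ∣ u ∣ + h → AtMost (λ x → DivisorsOf q x × InInterval u h x) K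
fewDivisors {u} {h} {K} {q} q≤A^K A-large xs !xs Pxs = ≮⇒≥ K≮length
  where
  S = suc K
  A = ∣ u ∣ + h
  3h≤A : 3 * h ≤ A
  3h≤A = ≤-trans (*-mono-≤ (m≤m^k 3 S) (m≤m^k h (S * S))) (<⇒≤ A-large)
  instance
    A≢0 : NonZero A
    A≢0 = >-nonZero (≤-<-trans z≤n A-large)
  K≮length : ¬ (K < length xs)
  K≮length K<l with take-suc K xs K<l
  ... | y , ys , eq , len = <⇒≱ A-large
    (manyDivisors⇒A-small {u} {h} {A} q≤A^K y ys len
      (subst Unique eq (Unique.take⁺ S !xs)) (All.map proj₁ Pys) (All.map proj₂ Pys)
      (All.map (interval-comparable {u} 3h≤A ∘ proj₂) Pys))
    where
    Pys : All (λ x → DivisorsOf q x × InInterval u h x) (y ∷ ys)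
    Pys = subst (All _) eq (All.take⁺ S Pxs)

-- The bound h^(1/9) for divisors in an interval.

module _ (K : ℕ) where

  private
    S = suc K
    T = S * S * S

  -- If |u| + h is large, at most K divisors occur. Otherwise q ≪ h^T with T = (K+1)³, and the
  -- divisor bound with exponent 1/(9T) gives t^(9T) ≪ h^T, that is t^9 ≪ h. The constant is the sum
  -- of those of the two cases.
  divisorBound⇒intervalDivisorBound : ∀ D → (∀ q .{{_ : NonZero q}} → HasDivisorBound (9 * T) D q) →
    ∀ u h q .{{_ : NonZero h}} .{{_ : NonZero q}} → q ≤ (∣ u ∣ + h) ^ K →
    ∃[ t ] t ^ 9 ≤ (K ^ 9 + D * 3 ^ (S * S)) * h × AtMost (λ x → DivisorsOf q x × InInterval u h x) t
  divisorBound⇒intervalDivisorBound D divisorBound u h q q≤A^K with ∣ u ∣ + h ≤? 3 ^ S * h ^ (S * S)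
  ... | no A≰ = K , ≤-trans (m≤m+n (K ^ 9) _) (m≤m*n (K ^ 9 + D * 3 ^ (S * S)) h) , fewDivisors {u} q≤A^K (≰⇒> A≰)
  ... | yes A≤ with divisorBound q
  ...   | t , atMost , t^9T≤ = t ,
    ≤-trans (^-cancelʳ-≤ T (begin
      (t ^ 9) ^ T                        ≡⟨ ^-*-assoc t 9 T ⟩
      t ^ (9 * T)                        ≤⟨ t^9T≤ ⟩
      D * q                              ≤⟨ *-monoʳ-≤ D q≤ ⟩
      D * (3 ^ (S * S) * h ^ T)          ≡⟨ *-assoc D _ _ ⟨
      C * h ^ T                          ≤⟨ *-monoˡ-≤ (h ^ T) (m≤m^k C T) ⟩
      C ^ T * h ^ T                      ≡⟨ ^-distribʳ-* T C h ⟨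
      (C * h) ^ T                        ∎)) (*-monoˡ-≤ h (m≤n+m C (K ^ 9))) ,
    AtMost-⊆ proj₁ atMost
    where
    open ≤-Reasoning
    A = ∣ u ∣ + h
    C = D * 3 ^ (S * S)
    instance
      A≢0 : NonZero A
      A≢0 = >-nonZero (≤-trans (>-nonZero⁻¹ h) (m≤n+m h ∣ u ∣))
    q≤ : q ≤ 3 ^ (S * S) * h ^ T
    q≤ = begin
      q                                   ≤⟨ q≤A^K ⟩
      A ^ K                               ≤⟨ ^-monoʳ-≤ A (n≤1+n K) ⟩
      A ^ S                               ≤⟨ ^-monoˡ-≤ S A≤ ⟩
      (3 ^ S * h ^ (S * S)) ^ S           ≡⟨ ^-distribʳ-* S (3 ^ S) _ ⟩
      (3 ^ S) ^ S * (h ^ (S * S)) ^ S     ≡⟨ cong₂ _*_ (^-*-assoc 3 S S) (^-*-assoc h (S * S) S) ⟩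
      3 ^ (S * S) * h ^ T                 ∎

  abstract
    -- The constant is chosen before `u`, `h` and `q`: this is the source of the uniformity over all
    -- boxes.
    intervalDivisorBound : ∃[ C ] ∀ u h q .{{_ : NonZero h}} .{{_ : NonZero q}} → q ≤ (∣ u ∣ + h) ^ K →
      ∃[ t ] t ^ 9 ≤ C * h × AtMost (λ x → DivisorsOf q x × InInterval u h x) t
    intervalDivisorBound with divisorBound (9 * T)
    ... | D , bound = K ^ 9 + D * 3 ^ (S * S) , divisorBound⇒intervalDivisorBound D bound

-- Finite sums and the Cauchy-Schwarz inequality.

module _ {A : Set} where

  ∑ : List A → (A → ℕ) → ℕ
  ∑ xs f = sum (map f xs)

  ∑-cong : ∀ xs {f g : A → ℕ} → (∀ x → f x ≡ g x) → ∑ xs f ≡ ∑ xs g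
  ∑-cong xs f≗g = cong sum (map-cong f≗g xs)

  ∑-mono : ∀ xs {f g : A → ℕ} → (∀ x → f x ≤ g x) → ∑ xs f ≤ ∑ xs g
  ∑-mono []       f≤g = z≤n
  ∑-mono (x ∷ xs) f≤g = +-mono-≤ (f≤g x) (∑-mono xs f≤g)

  ∑-const : ∀ (xs : List A) c → ∑ xs (λ _ → c) ≡ length xs * c
  ∑-const []       c = refl
  ∑-const (x ∷ xs) c = cong (c +_) (∑-const xs c)

  ∑-bound : ∀ xs {f : A → ℕ} {c} → (∀ x → f x ≤ c) → ∑ xs f ≤ length xs * c
  ∑-bound xs {c = c} f≤c = ≤-trans (∑-mono xs f≤c) (≤-reflexive (∑-const xs c))

  ∑-*ʳ : ∀ xs (f : A → ℕ) c → ∑ xs (λ x → f x * c) ≡ ∑ xs f * c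
  ∑-*ʳ []       f c = refl
  ∑-*ʳ (x ∷ xs) f c = trans (cong (f x * c +_) (∑-*ʳ xs f c)) (sym (*-distribʳ-+ c (f x) _))

  ∑-*ˡ : ∀ xs (f : A → ℕ) c → ∑ xs (λ x → c * f x) ≡ c * ∑ xs f
  ∑-*ˡ xs f c = trans (∑-cong xs λ x → *-comm c (f x)) (trans (∑-*ʳ xs f c) (*-comm _ c))

  ∑-+ : ∀ xs (f g : A → ℕ) → ∑ xs (λ x → f x + g x) ≡ ∑ xs f + ∑ xs g
  ∑-+ []       f g = refl
  ∑-+ (x ∷ xs) f g = trans (cong (f x + g x +_) (∑-+ xs f g)) (interchange +-commutativeSemigroup (f x) (g x) _ _)

  ∑-zero : ∀ xs {f : A → ℕ} → (∀ x → f x ≡ 0) → ∑ xs f ≡ 0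
  ∑-zero []       _   = refl
  ∑-zero (x ∷ xs) f≡0 = cong₂ _+_ (f≡0 x) (∑-zero xs f≡0)

  ∑≡0⊎∃≢0 : ∀ {P : Pred A 0ℓ} {xs} (f : A → ℕ) → All P xs → ∑ xs f ≡ 0 ⊎ ∃[ x ] P x × f x ≢ 0
  ∑≡0⊎∃≢0 f [] = inj₁ refl
  ∑≡0⊎∃≢0 {xs = x ∷ _} f (Px ∷ Pxs) with f x in fx≡ | ∑≡0⊎∃≢0 f Pxs
  ... | suc _ | _       = inj₂ (x , Px , λ fx≡0 → 0≢1+n (trans (sym fx≡0) fx≡))
  ... | zero  | inj₁ eq = inj₁ eq
  ... | zero  | inj₂ ex = inj₂ ex

  -- An empty sum needs no argument, so a bound may be proved with one nonzero term at hand. That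
  -- term serves as the reference point with which all others are compared.
  ∑-supported : ∀ {P : Pred A 0ℓ} {xs} (f : A → ℕ) {T} → All P xs →
    (∀ {x} → P x → f x ≢ 0 → ∑ xs f ≤ T) → ∑ xs f ≤ T
  ∑-supported f Pxs bound with ∑≡0⊎∃≢0 f Pxs
  ... | inj₁ ∑≡0            = ≤-trans (≤-reflexive ∑≡0) z≤n
  ... | inj₂ (x , Px , f≢0) = bound Px f≢0

  ∑-swap : ∀ {B : Set} xs (ys : List B) (f : A → B → ℕ) →
    ∑ xs (λ x → sum (map (f x) ys)) ≡ sum (map (λ y → ∑ xs (λ x → f x y)) ys)
  ∑-swap xs []       f = ∑-zero xs λ _ → refl
  ∑-swap xs (y ∷ ys) f = trans (∑-+ xs (λ x → f x y) _) (cong (∑ xs (λ x → f x y) +_) (∑-swap xs ys f))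

∑-map : ∀ {A B : Set} (g : A → B) xs (f : B → ℕ) → ∑ (map g xs) f ≡ ∑ xs (f ∘ g)
∑-map g xs f = cong sum (sym (map-∘ xs))

∑-concatMap : ∀ {A B : Set} (g : A → List B) xs (f : B → ℕ) → ∑ (concatMap g xs) f ≡ ∑ xs (λ x → ∑ (g x) f)
∑-concatMap g []       f = refl
∑-concatMap g (x ∷ xs) f = begin
  sum (map f (g x List.++ concatMap g xs))     ≡⟨ cong sum (map-++ f (g x) _) ⟩
  sum (map f (g x) List.++ map f (concatMap g xs))     ≡⟨ sum-++ (map f (g x)) _ ⟩
  ∑ (g x) f + ∑ (concatMap g xs) f                  ≡⟨ cong (∑ (g x) f +_) (∑-concatMap g xs f) ⟩
  ∑ (g x) f + ∑ xs (λ x → ∑ (g x) f)                ∎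
  where open ≡-Reasoning

2ab≤a²+b² : ∀ a b → 2 * (a * b) ≤ a * a + b * b
2ab≤a²+b² a b with ≤-total a b
... | inj₁ a≤b with k , refl ← m≤n⇒∃[o]m+o≡n a≤b = ≤-trans (m≤m+n _ (k * k)) (≤-reflexive (square a k))
  where
  square : ∀ a k → 2 * (a * (a + k)) + k * k ≡ a * a + (a + k) * (a + k)
  square = solve-∀
... | inj₂ b≤a with k , refl ← m≤n⇒∃[o]m+o≡n b≤a = ≤-trans (m≤m+n _ (k * k)) (≤-reflexive (square b k))
  where
  square : ∀ b k → 2 * ((b + k) * b) + k * k ≡ (b + k) * (b + k) + b * b
  square = solve-∀

-- Induction on the list: in (a + S)² the cross term 2aS is bounded by summing 2ab ≤ a² + b² over
-- the remaining entries.
cauchySchwarz : ∀ {A : Set} (xs : List A) f → ∑ xs f * ∑ xs f ≤ length xs * ∑ xs (λ x → f x * f x)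
cauchySchwarz []       f = z≤n
cauchySchwarz (x ∷ xs) f = begin
  (a + S) * (a + S)                           ≡⟨ expand a S ⟩
  a * a + 2 * (a * S) + S * S                 ≤⟨ +-mono-≤ (+-monoʳ-≤ (a * a) cross) (cauchySchwarz xs f) ⟩
  a * a + (l * (a * a) + Q) + l * Q           ≡⟨ collect (a * a) l Q ⟩
  (1 + l) * (a * a + Q)                       ∎
  where
  open ≤-Reasoning
  a = f x
  S = ∑ xs f
  l = length xs
  Q = ∑ xs (λ x → f x * f x)
  expand : ∀ a S → (a + S) * (a + S) ≡ a * a + 2 * (a * S) + S * S
  expand = solve-∀
  collect : ∀ b l Q → b + (l * b + Q) + l * Q ≡ (1 + l) * (b + Q)
  collect = solve-∀
  cross : 2 * (a * S) ≤ l * (a * a) + Q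
  cross = begin
    2 * (a * S)                              ≡⟨ cong (2 *_) (∑-*ˡ xs f a) ⟨
    2 * ∑ xs (λ y → a * f y)                 ≡⟨ ∑-*ˡ xs _ 2 ⟨
    ∑ xs (λ y → 2 * (a * f y))               ≤⟨ ∑-mono xs (λ y → 2ab≤a²+b² a (f y)) ⟩
    ∑ xs (λ y → a * a + f y * f y)           ≡⟨ ∑-+ xs _ _ ⟩
    ∑ xs (λ _ → a * a) + Q                   ≡⟨ cong (_+ Q) (∑-const xs (a * a)) ⟩
    l * (a * a) + Q                          ∎

-- Indicator functions and an incidence bound.

χ : {P : Set} → Dec P → ℕ
χ (yes _) = 1
χ (no _)  = 0

χ≢0 : {P : Set} (P? : Dec P) → χ P? ≢ 0 → P
χ≢0 (yes p) _   = p
χ≢0 (no _)  0≢0 = contradiction refl 0≢0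

χ-mono : {P Q : Set} (P? : Dec P) (Q? : Dec Q) → (P → Q) → χ P? ≤ χ Q?
χ-mono (no _)  _       _   = z≤n
χ-mono (yes _) (yes _) _   = ≤-refl
χ-mono (yes p) (no ¬q) P→Q = contradiction (P→Q p) ¬q

χ-yes : {P : Set} (P? : Dec P) → P → χ P? ≡ 1
χ-yes (yes _) _ = refl
χ-yes (no ¬p) p = contradiction p ¬p

χ≤1 : {P : Set} (P? : Dec P) → χ P? ≤ 1
χ≤1 (yes _) = ≤-refl
χ≤1 (no _)  = z≤n

length-filter-χ : ∀ {A : Set} {P : Pred A 0ℓ} (P? : Decidable P) xs → length (filter P? xs) ≡ ∑ xs (λ x → χ (P? x))
length-filter-χ P? []       = refl
length-filter-χ P? (x ∷ xs) with P? x
... | yes _ = cong suc (length-filter-χ P? xs)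
... | no _  = length-filter-χ P? xs

-- An incidence bound in the style of points and lines: `determined` confines the common neighbours
-- of `y` and `y′` with different `p` to one fibre of `q`. All fibres of `p` and `q` over nonzero
-- values have size at most `T`.
module Incidences {A B : Set} (Y : List A) (Z : List B) {R : A → B → Set} (R? : ∀ y z → Dec (R y z))
  (p : A → ℤ) (q : B → ℤ) (T : ℕ)
  (p≢0 : ∀ {y z} → R y z → p y ≢ ℤ.+ 0) (q≢0 : ∀ {y z} → R y z → q z ≢ ℤ.+ 0)
  (determined : ∀ {y y′ z z′} → p y ≢ p y′ → R y z → R y′ z → R y z′ → R y′ z′ → q z ≡ q z′)
  (countY : ∀ {Q} → Q ≢ ℤ.+ 0 → ∑ Y (λ y → χ (p y ℤ.≟ Q)) ≤ T)
  (countZ : ∀ {Q} → Q ≢ ℤ.+ 0 → ∑ Z (λ z → χ (q z ℤ.≟ Q)) ≤ T) where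

  private
    I : A → B → ℕ
    I y z = χ (R? y z)

    I*I≤1 : ∀ y y′ z → I y z * I y′ z ≤ 1
    I*I≤1 y y′ z = *-mono-≤ (χ≤1 (R? y z)) (χ≤1 (R? y′ z))

    I*I≢0 : ∀ y y′ z → I y z * I y′ z ≢ 0 → R y z × R y′ z
    I*I≢0 y y′ z ≢0 =
      χ≢0 (R? y z) (λ eq → ≢0 (cong (_* I y′ z) eq)) ,
      χ≢0 (R? y′ z) (λ eq → ≢0 (trans (cong (I y z *_) eq) (*-zeroʳ (I y z))))

    ≤χ : ∀ {n} {P : Set} (P? : Dec P) → n ≤ 1 → (n ≢ 0 → P) → n ≤ χ P?
    ≤χ {zero}  _       _   _  = z≤n
    ≤χ {suc _} (yes _) n≤1 _  = n≤1
    ≤χ {suc _} (no ¬p) _   ≢0 = contradiction (≢0 λ ()) ¬p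

    -- If the values of `p` agree, the trivial bound `length Z` is used; such `y′` are rare. If they
    -- differ, one common `z` fixes the value of `q` for all others, and `countZ` applies.
    common : ∀ y y′ → ∑ Z (λ z → I y z * I y′ z) ≤ χ (p y′ ℤ.≟ p y) * length Z + T
    common y y′ with p y′ ℤ.≟ p y
    ... | yes _ = begin
      ∑ Z (λ z → I y z * I y′ z)   ≤⟨ ∑-bound Z (I*I≤1 y y′) ⟩
      length Z * 1                 ≡⟨ *-comm (length Z) 1 ⟩
      1 * length Z                 ≤⟨ m≤m+n _ T ⟩
      1 * length Z + T             ∎
      where open ≤-Reasoning
    ... | no p≢ = ∑-supported (λ z → I y z * I y′ z) (All.universal (λ _ → refl) Z) single
      where
      single : ∀ {z} → z ≡ z → I y z * I y′ z ≢ 0 → ∑ Z (λ z → I y z * I y′ z) ≤ T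
      single {z} _ ≢0 with I*I≢0 y y′ z ≢0
      ... | Ryz , Ry′z = ≤-trans (∑-mono Z λ z′ → ≤χ (q z′ ℤ.≟ q z) (I*I≤1 y y′ z′) (same z′)) (countZ (q≢0 Ryz))
        where
        same : ∀ z′ → I y z′ * I y′ z′ ≢ 0 → q z′ ≡ q z
        same z′ ≢0 with I*I≢0 y y′ z′ ≢0
        ... | Ryz′ , Ry′z′ = determined (p≢ ∘ sym) Ryz′ Ry′z′ Ryz Ry′z

    fromY : ∀ y → ∑ Y (λ y′ → ∑ Z (λ z → I y z * I y′ z)) ≤ T * length Z + length Y * T
    fromY y with p y ℤ.≟ ℤ.+ 0
    -- `countY` speaks of nonzero values only. Where `p` vanishes there is no incidence, and the sum
    -- is 0.
    ... | yes py≡0 = ≤-trans (≤-reflexive (∑-zero Y λ y′ → ∑-zero Z λ z → cong (_* I y′ z) (I≡0 z))) z≤n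
      where
      I≡0 : ∀ z → I y z ≡ 0
      I≡0 z with R? y z
      ... | yes Ryz = contradiction py≡0 (p≢0 Ryz)
      ... | no _    = refl
    ... | no py≢0 = begin
      ∑ Y (λ y′ → ∑ Z (λ z → I y z * I y′ z))               ≤⟨ ∑-mono Y (common y) ⟩
      ∑ Y (λ y′ → χ (p y′ ℤ.≟ p y) * length Z + T)          ≡⟨ ∑-+ Y _ _ ⟩
      ∑ Y (λ y′ → χ (p y′ ℤ.≟ p y) * length Z) + ∑ Y (λ _ → T)  ≡⟨ cong₂ _+_ (∑-*ʳ Y _ (length Z)) (∑-const Y T) ⟩
      ∑ Y (λ y′ → χ (p y′ ℤ.≟ p y)) * length Z + length Y * T   ≤⟨ +-monoˡ-≤ _ (*-monoˡ-≤ (length Z) (countY py≢0)) ⟩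
      T * length Z + length Y * T                           ∎
      where open ≤-Reasoning

  incidences² : let N = ∑ Y (λ y → ∑ Z (λ z → χ (R? y z))) in
    N * N ≤ length Z * (length Y * (T * length Z + length Y * T))
  incidences² = begin
    N * N                                                       ≡⟨ cong₂ _*_ (∑-swap Y Z I) (∑-swap Y Z I) ⟩
    ∑ Z deg * ∑ Z deg                                           ≤⟨ cauchySchwarz Z deg ⟩
    length Z * ∑ Z (λ z → deg z * deg z)                        ≡⟨ cong (length Z *_) pairs ⟩
    length Z * ∑ Y (λ y → ∑ Y (λ y′ → ∑ Z (λ z → I y z * I y′ z)))  ≤⟨ *-monoʳ-≤ (length Z) (∑-bound Y fromY) ⟩
    length Z * (length Y * (T * length Z + length Y * T))       ∎
    where
    open ≤-Reasoning
    N = ∑ Y (λ y → ∑ Z (I y))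
    deg : B → ℕ
    deg z = ∑ Y (λ y → I y z)
    -- The second moment of the degrees counts the triples of `y`, `y′` and a common neighbour `z`.
    pairs : ∑ Z (λ z → deg z * deg z) ≡ ∑ Y (λ y → ∑ Y (λ y′ → ∑ Z (λ z → I y z * I y′ z)))
    pairs = trans
      (∑-cong Z λ z → trans (sym (∑-*ʳ Y (λ y → I y z) (deg z))) (∑-cong Y λ y → sym (∑-*ˡ Y (λ y′ → I y′ z) (I y z))))
      (trans (∑-swap Z Y _) (∑-cong Y λ y → ∑-swap Z Y _))

-- Sums over the points of a box.

∑-offsets-∷ : ∀ m h (f : Vec ℕ (suc m) → ℕ) →
  ∑ (offsets (suc m) h) f ≡ ∑ (upTo h) (λ a → ∑ (offsets m h) (λ j → f (a ∷ j)))
∑-offsets-∷ m h f = trans (∑-concatMap _ (upTo h) f) (∑-cong (upTo h) λ a → ∑-map (a ∷_) (offsets m h) f)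

-- Brings an arbitrary coordinate `i` to the outermost sum; it will be the one whose interval lies
-- farthest from the origin.
∑-offsets-insertAt : ∀ m h (i : Fin (suc m)) (f : Vec ℕ (suc m) → ℕ) →
  ∑ (offsets (suc m) h) f ≡ ∑ (upTo h) (λ a → ∑ (offsets m h) (λ j → f (insertAt j i a)))
∑-offsets-insertAt m       h zero    f = ∑-offsets-∷ m h f
∑-offsets-insertAt (suc m) h (suc i) f = begin
  ∑ (offsets (suc (suc m)) h) f                                                           ≡⟨ ∑-offsets-∷ (suc m) h f ⟩
  ∑ (upTo h) (λ b → ∑ (offsets (suc m) h) (λ j → f (b ∷ j)))                              ≡⟨ ∑-cong (upTo h) (λ b → ∑-offsets-insertAt m h i (λ j → f (b ∷ j))) ⟩
  ∑ (upTo h) (λ b → ∑ (upTo h) (λ a → ∑ (offsets m h) (λ j → f (b ∷ insertAt j i a))))    ≡⟨ ∑-swap (upTo h) (upTo h) _ ⟩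
  ∑ (upTo h) (λ a → ∑ (upTo h) (λ b → ∑ (offsets m h) (λ j → f (b ∷ insertAt j i a))))    ≡⟨ ∑-cong (upTo h) (λ a → ∑-offsets-∷ m h (λ j → f (insertAt j (suc i) a))) ⟨
  ∑ (upTo h) (λ a → ∑ (offsets (suc m) h) (λ j → f (insertAt j (suc i) a)))               ∎
  where open ≡-Reasoning

∑-offsets-++ : ∀ m n h (f : Vec ℕ (m + n) → ℕ) →
  ∑ (offsets (m + n) h) f ≡ ∑ (offsets m h) (λ i → ∑ (offsets n h) (λ j → f (i ++ j)))
∑-offsets-++ zero    n h f = sym (+-identityʳ _)
∑-offsets-++ (suc m) n h f = begin
  ∑ (offsets (suc m + n) h) f                                                         ≡⟨ ∑-offsets-∷ (m + n) h f ⟩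
  ∑ (upTo h) (λ a → ∑ (offsets (m + n) h) (λ j → f (a ∷ j)))                          ≡⟨ ∑-cong (upTo h) (λ a → ∑-offsets-++ m n h (λ j → f (a ∷ j))) ⟩
  ∑ (upTo h) (λ a → ∑ (offsets m h) (λ i → ∑ (offsets n h) (λ j → f (a ∷ i ++ j))))   ≡⟨ ∑-offsets-∷ m h _ ⟨
  ∑ (offsets (suc m) h) (λ i → ∑ (offsets n h) (λ j → f (i ++ j)))                    ∎
  where open ≡-Reasoning

length≡∑1 : ∀ {A : Set} (xs : List A) → length xs ≡ ∑ xs (λ _ → 1)
length≡∑1 xs = trans (sym (*-identityʳ _)) (sym (∑-const xs 1))

length-offsets : ∀ m h → length (offsets m h) ≡ h ^ m
length-offsets zero    h = refl
length-offsets (suc m) h = begin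
  length (offsets (suc m) h)                        ≡⟨ length≡∑1 (offsets (suc m) h) ⟩
  ∑ (offsets (suc m) h) (λ _ → 1)                   ≡⟨ ∑-offsets-∷ m h (λ _ → 1) ⟩
  ∑ (upTo h) (λ _ → ∑ (offsets m h) (λ _ → 1))      ≡⟨ ∑-const (upTo h) _ ⟩
  length (upTo h) * ∑ (offsets m h) (λ _ → 1)       ≡⟨ cong₂ _*_ (length-upTo h) (trans (sym (length≡∑1 (offsets m h))) (length-offsets m h)) ⟩
  h * h ^ m                                         ∎
  where open ≡-Reasoning

offsets-< : ∀ m h → All (VecAll (_< h)) (offsets m h)
offsets-< zero    h = [] ∷ []
offsets-< (suc m) h = All.concat⁺ (All.map⁺ (All.map (λ a<h → All.map⁺ (All.map (a<h ∷_) (offsets-< m h))) (All.all-upTo h)))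

module _ {A : Set} where

  VecAll-insertAt⁻ : ∀ {P : Pred A 0ℓ} {m} {xs : Vec A m} i {x} → VecAll P (insertAt xs i x) → P x × VecAll P xs
  VecAll-insertAt⁻               zero    (Px ∷ Pxs) = Px , Pxs
  VecAll-insertAt⁻ {xs = _ ∷ _}  (suc i) (Py ∷ Pxs) with VecAll-insertAt⁻ i Pxs
  ... | Px , Pxs′ = Px , Py ∷ Pxs′

  insertAt-view : ∀ {m} (xs : Vec A (suc m)) i → ∃[ x ] ∃[ ys ] xs ≡ insertAt ys i x
  insertAt-view xs i = lookup xs i , Vec.removeAt xs i , sym (insertAt-removeAt xs i)

-- Points of a box at which a monomial takes a given value.

zipWith-insertAt : ∀ {A B C : Set} (f : A → B → C) {m} (xs : Vec A m) (ys : Vec B m) i x y →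
  zipWith f (insertAt xs i x) (insertAt ys i y) ≡ insertAt (zipWith f xs ys) i (f x y)
zipWith-insertAt f xs       ys       zero    x y = refl
zipWith-insertAt f (a ∷ xs) (b ∷ ys) (suc i) x y = cong (f a b ∷_) (zipWith-insertAt f xs ys i x y)

sum-insertAt : ∀ {m} (ks : Vec ℕ m) i k → Vec.sum (insertAt ks i k) ≡ k + Vec.sum ks
sum-insertAt ks       zero    k = refl
sum-insertAt (l ∷ ks) (suc i) k = trans (cong (l +_) (sum-insertAt ks i k)) (x∙yz≈y∙xz +-commutativeSemigroup l k (Vec.sum ks))

monomial-insertAt : ∀ {m} (ks : Vec ℕ m) xs i k x →
  monomial (insertAt ks i k) (insertAt xs i x) ≡ x ℤ.^ k ℤ.* monomial ks xs
monomial-insertAt ks       xs       zero    k x = refl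
monomial-insertAt (l ∷ ks) (y ∷ xs) (suc i) k x =
  trans (cong (y ℤ.^ l ℤ.*_) (monomial-insertAt ks xs i k x)) (swap (y ℤ.^ l) (x ℤ.^ k) (monomial ks xs))
  where
  swap : ∀ a b c → a ℤ.* (b ℤ.* c) ≡ b ℤ.* (a ℤ.* c)
  swap = ℤ.solve-∀

maximalEntry : ∀ {m} (us : Vec ℤ (suc m)) → ∃[ i ] ∃[ u ] ∃[ vs ] us ≡ insertAt vs i u × VecAll (λ v → ∣ v ∣ ≤ ∣ u ∣) us
maximalEntry (u ∷ [])     = zero , u , [] , refl , ≤-refl ∷ []
maximalEntry (v ∷ us@(_ ∷ _)) with maximalEntry us
... | i , u , vs , us≡ , us≤u with ∣ v ∣ ≤? ∣ u ∣
...   | yes v≤u = suc i , u , v ∷ vs , cong (v ∷_) us≡ , v≤u ∷ us≤u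
...   | no v≰u  = zero , v , us , refl , ≤-refl ∷ VecAll.map (λ w≤u → ≤-trans w≤u (≰⇒≥ v≰u)) us≤u

∣^∣ : ∀ x k → ∣ x ℤ.^ k ∣ ≡ ∣ x ∣ ^ k
∣^∣ x zero    = refl
∣^∣ x (suc k) = trans (ℤ.abs-* x (x ℤ.^ k)) (cong (∣ x ∣ *_) (∣^∣ x k))

∣monomial∣≤ : ∀ {m U h} (ks : Vec ℕ m) us js → VecAll (λ u → ∣ u ∣ ≤ U) us → VecAll (_< h) js →
  ∣ monomial ks (boxPoint us js) ∣ ≤ (U + h) ^ Vec.sum ks
∣monomial∣≤         []       []       []       _            _            = ≤-refl
∣monomial∣≤ {U = U} {h} (k ∷ ks) (u ∷ us) (j ∷ js) (u≤U ∷ us≤U) (j<h ∷ js<h) = begin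
  ∣ x ℤ.^ k ℤ.* monomial ks (boxPoint us js) ∣            ≡⟨ ℤ.abs-* (x ℤ.^ k) _ ⟩
  ∣ x ℤ.^ k ∣ * ∣ monomial ks (boxPoint us js) ∣          ≡⟨ cong (_* _) (∣^∣ x k) ⟩
  ∣ x ∣ ^ k * ∣ monomial ks (boxPoint us js) ∣            ≤⟨ *-mono-≤ (^-monoˡ-≤ k x≤) (∣monomial∣≤ ks us js us≤U js<h) ⟩
  (U + h) ^ k * (U + h) ^ Vec.sum ks                      ≡⟨ ^-distribˡ-+-* (U + h) k _ ⟨
  (U + h) ^ (k + Vec.sum ks)                              ∎
  where
  open ≤-Reasoning
  x = u ℤ.+ ℤ.+ suc j
  x≤ : ∣ x ∣ ≤ U + h
  x≤ = ≤-trans (ℤ.∣i+j∣≤∣i∣+∣j∣ u (ℤ.+ suc j)) (+-mono-≤ u≤U j<h)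

-- Distinct offsets give distinct integers, so a bound for the divisors in the interval bounds the
-- number of offsets.
intervalCount : ∀ u h q {t} → AtMost (λ x → DivisorsOf q x × InInterval u h x) t →
  ∑ (upTo h) (λ a → χ (∣ u ℤ.+ ℤ.+ suc a ∣ ∣? q)) ≤ t
intervalCount u h q {t} atMost = begin
  ∑ (upTo h) (λ a → χ (∣ x a ∣ ∣? q))    ≡⟨ length-filter-χ P? (upTo h) ⟨
  length as                              ≡⟨ length-map x as ⟨
  length (map x as)                      ≤⟨ atMost (map x as)
    (Unique.map⁺ x-injective (Unique.filter⁺ P? (Unique.upTo⁺ h)))
    (All.map⁺ (All.zip (All.all-filter P? (upTo h) , All.map (λ {a} a<h → a , a<h , refl) (All.filter⁺ P? (All.all-upTo h))))) ⟩
  t                                      ∎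
  where
  open ≤-Reasoning
  x : ℕ → ℤ
  x a = u ℤ.+ ℤ.+ suc a
  P? : Decidable (λ a → DivisorsOf q (x a))
  P? a = ∣ x a ∣ ∣? q
  as = filter P? (upTo h)
  x-injective : ∀ {a b} → x a ≡ x b → a ≡ b
  x-injective xa≡xb = suc-injective (ℤ.+-injective (∙-cancelˡ u _ _ xa≡xb))
    where open import Algebra.Properties.AbelianGroup ℤ.+-0-abelianGroup using (∙-cancelˡ)

-- Induction on the dimension, splitting off the coordinate with the largest |u|. This coordinate
-- divides `Q`, so by `intervalDivisorBound` it takes at most `t` values. Once it is fixed, the
-- remaining monomial has one nonzero value, and the induction hypothesis bounds the fibre.
boxMonomialCount : ∀ K → let C = proj₁ (intervalDivisorBound K) in
  ∀ {m} (ks : Vec ℕ m) → VecAll NonZero ks → Vec.sum ks ≤ K → ∀ us h .{{_ : NonZero h}} {Q} → Q ≢ ℤ.+ 0 →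
  ∑ (offsets m h) (λ js → χ (monomial ks (boxPoint us js) ℤ.≟ Q)) ^ 9 ≤ C ^ m * h ^ m
boxMonomialCount K []         _ _ []  h {Q} _ = ^-monoˡ-≤ 9 {_} {1} (≤-trans (≤-reflexive (+-identityʳ _)) (χ≤1 (ℤ.+ 1 ℤ.≟ Q)))
boxMonomialCount K {suc m} ks ks≢0 ∑ks≤K us h {Q} Q≢0 with maximalEntry us
... | i , u , us′ , refl , us≤u with insertAt-view ks i
... | k , ks′ , refl with VecAll-insertAt⁻ i ks≢0
-- A point of the box with value `Q` is what yields |Q| ≤ (|u| + h)^K; if there is none, the count
-- is 0.
... | k≢0 , ks′≢0 with ∑≡0⊎∃≢0 (λ js → χ (monomial (insertAt ks′ i k) (boxPoint (insertAt us′ i u) js) ℤ.≟ Q)) (offsets-< (suc m) h)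
... | inj₁ N≡0 = subst (λ N → N ^ 9 ≤ _) (sym N≡0) z≤n
... | inj₂ (js , js<h , F≢0) = begin
    N ^ 9                              ≤⟨ ^-monoˡ-≤ 9 N≤t*T ⟩
    (t * T) ^ 9                        ≡⟨ ^-distribʳ-* 9 t T ⟩
    t ^ 9 * T ^ 9                      ≤⟨ *-mono-≤ t⁹≤ T⁹≤ ⟩
    C * h * (C ^ m * h ^ m)            ≡⟨ [m*n]*[o*p]≡[m*o]*[n*p] C h (C ^ m) (h ^ m) ⟩
    C ^ suc m * h ^ suc m              ∎
  where
  open ≤-Reasoning
  C = proj₁ (intervalDivisorBound K)
  F : Vec ℕ (suc m) → ℕ
  F js = χ (monomial (insertAt ks′ i k) (boxPoint (insertAt us′ i u) js) ℤ.≟ Q)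
  N = ∑ (offsets (suc m) h) F
  x : ℕ → ℤ
  x a = u ℤ.+ ℤ.+ suc a
  M : Vec ℕ m → ℤ
  M js = monomial ks′ (boxPoint us′ js)

  monomial≡ : ∀ a js →
    monomial (insertAt ks′ i k) (boxPoint (insertAt us′ i u) (insertAt js i a)) ≡ x a ℤ.^ k ℤ.* M js
  monomial≡ a js = trans
    (cong (monomial (insertAt ks′ i k)) (zipWith-insertAt _ us′ js i u a))
    (monomial-insertAt ks′ (boxPoint us′ js) i k (x a))

  instance
    A≢0 : NonZero (∣ u ∣ + h)
    A≢0 = >-nonZero (≤-trans (>-nonZero⁻¹ h) (m≤n+m h ∣ u ∣))
    Q-nonZero : ℤ.NonZero Q
    Q-nonZero = ℤ.≢-nonZero Q≢0

  ∑ks′≤K : Vec.sum ks′ ≤ K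
  ∑ks′≤K = ≤-trans (m≤n+m _ k) (subst (_≤ K) (sum-insertAt ks′ i k) ∑ks≤K)

  Q≤A^K : ∣ Q ∣ ≤ (∣ u ∣ + h) ^ K
  Q≤A^K = subst (λ Q → ∣ Q ∣ ≤ (∣ u ∣ + h) ^ K) (χ≢0 (_ ℤ.≟ Q) F≢0)
    (≤-trans (∣monomial∣≤ _ _ js us≤u js<h) (^-monoʳ-≤ (∣ u ∣ + h) ∑ks≤K))

  divisors = proj₂ (intervalDivisorBound K) u h ∣ Q ∣ Q≤A^K
  t = proj₁ divisors
  t⁹≤ = proj₁ (proj₂ divisors)
  -- The same bound `T` serves every fibre, whatever the value of its remaining monomial.
  T = proj₁ (root 9 (C ^ m * h ^ m))
  T⁹≤ = proj₁ (proj₂ (root 9 (C ^ m * h ^ m)))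

  fibre : ∀ a → ∑ (offsets m h) (λ js → F (insertAt js i a)) ≤ χ (∣ x a ∣ ∣? ∣ Q ∣) * T
  fibre a = ∑-supported (λ js → F (insertAt js i a)) (offsets-< m h) λ {js} _ F≢0 → bound js
    (trans (sym (monomial≡ a js)) (χ≢0 (_ ℤ.≟ Q) F≢0))
    where
    bound : ∀ js → x a ℤ.^ k ℤ.* M js ≡ Q → ∑ (offsets m h) (λ js → F (insertAt js i a)) ≤ χ (∣ x a ∣ ∣? ∣ Q ∣) * T
    bound js xᵏM≡Q = begin
      ∑ (offsets m h) (λ js → F (insertAt js i a))          ≤⟨ ∑-mono (offsets m h) (λ js′ → χ-mono (_ ℤ.≟ Q) (M js′ ℤ.≟ M js) (cancel js′)) ⟩
      ∑ (offsets m h) (λ js′ → χ (M js′ ℤ.≟ M js))          ≤⟨ proj₂ (proj₂ (root 9 (C ^ m * h ^ m))) (boxMonomialCount K ks′ ks′≢0 ∑ks′≤K us′ h M≢0) ⟩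
      T                                                     ≡⟨ *-identityˡ T ⟨
      1 * T                                                 ≡⟨ cong (_* T) (χ-yes (∣ x a ∣ ∣? ∣ Q ∣) x∣Q) ⟨
      χ (∣ x a ∣ ∣? ∣ Q ∣) * T                              ∎
      where
      xᵏ≢0 : x a ℤ.^ k ≢ ℤ.+ 0
      xᵏ≢0 xᵏ≡0 = Q≢0 (trans (sym xᵏM≡Q) (cong (ℤ._* M js) xᵏ≡0))
      M≢0 : M js ≢ ℤ.+ 0
      M≢0 M≡0 = Q≢0 (trans (sym xᵏM≡Q) (trans (cong (x a ℤ.^ k ℤ.*_) M≡0) (ℤ.*-zeroʳ (x a ℤ.^ k))))
      -- Cancelling the nonzero power shows that the remaining monomial is constant along the fibre.
      cancel : ∀ js′ → monomial (insertAt ks′ i k) (boxPoint (insertAt us′ i u) (insertAt js′ i a)) ≡ Q → M js′ ≡ M js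
      cancel js′ eq = ℤ.*-cancelˡ-≡ (x a ℤ.^ k) _ _ {{ℤ.≢-nonZero xᵏ≢0}}
        (trans (sym (monomial≡ a js′)) (trans eq (sym xᵏM≡Q)))
      x∣Q : DivisorsOf ∣ Q ∣ (x a)
      x∣Q = subst (λ Q → DivisorsOf ∣ Q ∣ (x a)) xᵏM≡Q
        (subst (DivisorsOf′ (x a)) (sym (ℤ.abs-* (x a ℤ.^ k) (M js)))
          (∣m⇒∣m*n ∣ M js ∣ (subst (DivisorsOf′ (x a)) (sym (∣^∣ (x a) k)) (base∣power {x a} k≢0))))
        where
        DivisorsOf′ : ℤ → ℕ → Set
        DivisorsOf′ y q = DivisorsOf q y
        base∣power : ∀ {y k} → NonZero k → DivisorsOf (∣ y ∣ ^ k) y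
        base∣power {y} {suc k} _ = m∣m*n (∣ y ∣ ^ k)

  N≤t*T : N ≤ t * T
  N≤t*T = begin
    N                                                                  ≡⟨ ∑-offsets-insertAt m h i F ⟩
    ∑ (upTo h) (λ a → ∑ (offsets m h) (λ js → F (insertAt js i a)))    ≤⟨ ∑-mono (upTo h) fibre ⟩
    ∑ (upTo h) (λ a → χ (∣ x a ∣ ∣? ∣ Q ∣) * T)                        ≡⟨ ∑-*ʳ (upTo h) (λ a → χ (∣ x a ∣ ∣? ∣ Q ∣)) T ⟩
    ∑ (upTo h) (λ a → χ (∣ x a ∣ ∣? ∣ Q ∣)) * T                        ≤⟨ *-monoˡ-≤ T (intervalCount u h ∣ Q ∣ (proj₂ (proj₂ divisors))) ⟩
    t * T                                                              ∎

-- Splitting the equation into blocks of variables.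

boxPoint-++ : ∀ {m n} (us : Vec ℤ m) (vs : Vec ℤ n) is js →
  boxPoint (us ++ vs) (is ++ js) ≡ boxPoint us is ++ boxPoint vs js
boxPoint-++ []       vs []       js = refl
boxPoint-++ (u ∷ us) vs (i ∷ is) js = cong (_ ∷_) (boxPoint-++ us vs is js)

lhs-++ : ∀ {m n} (fs : Vec Poly m) (gs : Vec Poly n) xs ys → lhs (fs ++ gs) (xs ++ ys) ≡ lhs fs xs ℤ.+ lhs gs ys
lhs-++ []       gs []       ys = sym (ℤ.+-identityˡ _)
lhs-++ (f ∷ fs) gs (x ∷ xs) ys = trans (cong (λ s → eval f x ℤ.+ s) (lhs-++ fs gs xs ys)) (sym (ℤ.+-assoc (eval f x) _ _))

monomial-++ : ∀ {m n} (ks : Vec ℕ m) (ls : Vec ℕ n) xs ys →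
  monomial (ks ++ ls) (xs ++ ys) ≡ monomial ks xs ℤ.* monomial ls ys
monomial-++ []       ls []       ys = sym (ℤ.*-identityˡ _)
monomial-++ (k ∷ ks) ls (x ∷ xs) ys = trans (cong (λ s → x ℤ.^ k ℤ.* s) (monomial-++ ks ls xs ys)) (sym (ℤ.*-assoc (x ℤ.^ k) _ _))

*-≢0⁻ : ∀ i j → i ℤ.* j ≢ ℤ.+ 0 → i ≢ ℤ.+ 0 × j ≢ ℤ.+ 0
*-≢0⁻ i j ij≢0 = (λ { refl → ij≢0 refl }) , (λ { refl → ij≢0 (ℤ.*-zeroʳ i) })

AllNonzero-++⁻ : ∀ {m n} (xs : Vec ℤ m) (ys : Vec ℤ n) → AllNonzero (xs ++ ys) → AllNonzero xs × AllNonzero ys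
AllNonzero-++⁻ []       ys ≢0 = (λ ()) , ≢0
AllNonzero-++⁻ (x ∷ xs) ys ≢0 with *-≢0⁻ x _ ≢0
... | x≢0 , xs++ys≢0 with AllNonzero-++⁻ xs ys xs++ys≢0
...   | xs≢0 , ys≢0 = *-≢0 x≢0 xs≢0 , ys≢0

monomial≢0 : ∀ {m} (ks : Vec ℕ m) xs → AllNonzero xs → monomial ks xs ≢ ℤ.+ 0
monomial≢0 []       []       _  = λ ()
monomial≢0 (k ∷ ks) (x ∷ xs) ≢0 with *-≢0⁻ x _ ≢0
... | x≢0 , xs≢0 = *-≢0 (x≢0 ∘ ℤ.i^n≡0⇒i≡0 x k) (monomial≢0 ks xs xs≢0)

-- Subtracting the first two equations gives a m (p - p′) q = F - F′, and the last two give the same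
-- with q′. The factor a m (p - p′) is nonzero and cancels.
lines-determine : ∀ {a m F F′ G G′ p p′ q q′} H → a ≢ ℤ.+ 0 → m ≢ ℤ.+ 0 → p ≢ p′ →
  F  ℤ.+ (G  ℤ.+ H) ≡ a ℤ.* (p  ℤ.* (q  ℤ.* m)) → F′ ℤ.+ (G  ℤ.+ H) ≡ a ℤ.* (p′ ℤ.* (q  ℤ.* m)) →
  F  ℤ.+ (G′ ℤ.+ H) ≡ a ℤ.* (p  ℤ.* (q′ ℤ.* m)) → F′ ℤ.+ (G′ ℤ.+ H) ≡ a ℤ.* (p′ ℤ.* (q′ ℤ.* m)) → q ≡ q′
lines-determine {a} {m} {F} {F′} {G} {G′} {p} {p′} {q} {q′} H a≢0 m≢0 p≢p′ e₁ e₂ e₃ e₄ =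
  ℤ.*-cancelˡ-≡ (a ℤ.* m ℤ.* (p ℤ.- p′)) q q′
    {{ℤ.≢-nonZero (*-≢0 (*-≢0 a≢0 m≢0) (p≢p′ ∘ ℤ.i-j≡0⇒i≡j p p′))}}
    (trans (slope G q e₁ e₂) (sym (slope G′ q′ e₃ e₄)))
  where
  slope : ∀ G q → F ℤ.+ (G ℤ.+ H) ≡ a ℤ.* (p ℤ.* (q ℤ.* m)) → F′ ℤ.+ (G ℤ.+ H) ≡ a ℤ.* (p′ ℤ.* (q ℤ.* m)) →
    a ℤ.* m ℤ.* (p ℤ.- p′) ℤ.* q ≡ F ℤ.- F′
  slope G q e e′ = trans (expand a m p p′ q) (trans (cong₂ ℤ._-_ (sym e) (sym e′)) (cancel F F′ (G ℤ.+ H)))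
    where
    expand : ∀ a m p p′ q → a ℤ.* m ℤ.* (p ℤ.- p′) ℤ.* q ≡ a ℤ.* (p ℤ.* (q ℤ.* m)) ℤ.- a ℤ.* (p′ ℤ.* (q ℤ.* m))
    expand = ℤ.solve-∀
    cancel : ∀ F F′ S → F ℤ.+ S ℤ.- (F′ ℤ.+ S) ≡ F ℤ.- F′
    cancel = ℤ.solve-∀

-- The ninth power of N² ≤ D T h^(3r) gives N^18 ≤ D^9 E h^(28r), and a square root yields the
-- claim.
sliceArithmetic : ∀ {N T} h r D E → T ^ 9 ≤ E * h ^ r → N * N ≤ h ^ r * (h ^ r * (D * (T * h ^ r))) →
  N ^ 9 ≤ (D ^ 9 * E) ^ 9 * h ^ (14 * r)
sliceArithmetic {N} {T} h r D E T⁹≤ N²≤ = ^-cancelʳ-≤ 2 (begin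
  (N ^ 9) ^ 2                                           ≡⟨ square (N ^ 9) ⟩
  N ^ 9 * N ^ 9                                         ≡⟨ ^-distribʳ-* 9 N N ⟨
  (N * N) ^ 9                                           ≤⟨ ^-monoˡ-≤ 9 N²≤ ⟩
  (H * (H * (D * (T * H)))) ^ 9                         ≡⟨ powers ⟩
  D ^ 9 * T ^ 9 * (H ^ 9 * (H ^ 9 * H ^ 9))             ≤⟨ *-monoˡ-≤ _ (*-monoʳ-≤ (D ^ 9) T⁹≤) ⟩
  D ^ 9 * (E * H) * (H ^ 9 * (H ^ 9 * H ^ 9))           ≡⟨ collect (D ^ 9) E H (H ^ 9) ⟩
  -- Enlarging `c` to its 18th power makes the whole right side a perfect square.
  c * (H * (H ^ 9 * (H ^ 9 * H ^ 9)))                   ≤⟨ *-monoˡ-≤ _ (m≤m^k c 18) ⟩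
  c ^ 18 * (H * (H ^ 9 * (H ^ 9 * H ^ 9)))              ≡⟨ cong₂ _*_ (sym (^-*-assoc c 9 2)) H²⁸ ⟩
  (c ^ 9) ^ 2 * (h ^ (14 * r)) ^ 2                      ≡⟨ ^-distribʳ-* 2 (c ^ 9) _ ⟨
  (c ^ 9 * h ^ (14 * r)) ^ 2                            ∎)
  where
  open ≤-Reasoning
  c = D ^ 9 * E
  H = h ^ r
  square : ∀ n → n ^ 2 ≡ n * n
  square n = cong (n *_) (*-identityʳ n)
  collect : ∀ a b H G → a * (b * H) * (G * (G * G)) ≡ a * b * (H * (G * (G * G)))
  collect = solve-∀
  rearrange : ∀ G V U → G * (G * (V * (U * G))) ≡ V * U * (G * (G * G))
  rearrange = solve-∀
  powers : (H * (H * (D * (T * H)))) ^ 9 ≡ D ^ 9 * T ^ 9 * (H ^ 9 * (H ^ 9 * H ^ 9))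
  powers = trans (^-distribʳ-* 9 H _) (trans (cong (H ^ 9 *_) (trans (^-distribʳ-* 9 H _) (cong (H ^ 9 *_)
    (trans (^-distribʳ-* 9 D _) (cong (D ^ 9 *_) (^-distribʳ-* 9 T H)))))) (rearrange (H ^ 9) (D ^ 9) (T ^ 9)))
  H²⁸ : H * (H ^ 9 * (H ^ 9 * H ^ 9)) ≡ (h ^ (14 * r)) ^ 2
  H²⁸ = trans (cong (λ s → H * (H ^ 9 * s)) (sym (^-distribˡ-+-* H 9 9)))
    (trans (cong (H *_) (sym (^-distribˡ-+-* H 9 18)))
    (trans (^-*-assoc h r 28)
    (trans (cong (h ^_) (28r r)) (sym (^-*-assoc h (14 * r) 2)))))
    where
    28r : ∀ r → r * 28 ≡ 14 * r * 2
    28r = solve-∀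

-- Fixing the last `k` coordinates leaves h^k slices, each of size at most the ninth root of `X`.
∑-slices-≤ : ∀ m k h (f : Vec ℕ (m + (m + k)) → ℕ) {X} →
  (∀ l → ∑ (offsets m h) (λ i → ∑ (offsets m h) (λ j → f (i ++ j ++ l))) ^ 9 ≤ X) →
  ∑ (offsets (m + (m + k)) h) f ^ 9 ≤ h ^ (k * 9) * X
∑-slices-≤ m k h f {X} slice⁹≤X = begin
  ∑ (offsets (m + (m + k)) h) f ^ 9   ≤⟨ ^-monoˡ-≤ 9 ∑f≤ ⟩
  (h ^ k * S) ^ 9                     ≡⟨ ^-distribʳ-* 9 (h ^ k) S ⟩
  (h ^ k) ^ 9 * S ^ 9                 ≤⟨ *-mono-≤ (≤-reflexive (^-*-assoc h k 9)) (proj₁ (proj₂ (root 9 X))) ⟩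
  h ^ (k * 9) * X                     ∎
  where
  open ≤-Reasoning
  S = proj₁ (root 9 X)
  box = offsets m h
  ∑f≤ : ∑ (offsets (m + (m + k)) h) f ≤ h ^ k * S
  ∑f≤ = begin
    ∑ (offsets (m + (m + k)) h) f                                               ≡⟨ ∑-offsets-++ m (m + k) h f ⟩
    ∑ box (λ i → ∑ (offsets (m + k) h) (λ j → f (i ++ j)))                      ≡⟨ ∑-cong box (λ i → ∑-offsets-++ m k h (λ j → f (i ++ j))) ⟩
    ∑ box (λ i → ∑ box (λ j → ∑ (offsets k h) (λ l → f (i ++ j ++ l))))         ≡⟨ ∑-cong box (λ i → ∑-swap box (offsets k h) (λ j l → f (i ++ j ++ l))) ⟩
    ∑ box (λ i → ∑ (offsets k h) (λ l → ∑ box (λ j → f (i ++ j ++ l))))         ≡⟨ ∑-swap box (offsets k h) (λ i l → ∑ box (λ j → f (i ++ j ++ l))) ⟩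
    ∑ (offsets k h) (λ l → ∑ box (λ i → ∑ box (λ j → f (i ++ j ++ l))))         ≤⟨ ∑-bound (offsets k h) (λ l → proj₂ (proj₂ (root 9 X)) (slice⁹≤X l)) ⟩
    length (offsets k h) * S                                                    ≡⟨ cong (_* S) (length-offsets k h) ⟩
    h ^ k * S                                                                   ∎

collectExponents : ∀ h r k c → h ^ (k * 9) * (c * h ^ (14 * r)) ≡ c * h ^ (9 * (r + (r + k)) ∸ 4 * r)
collectExponents h r k c = begin
  h ^ (k * 9) * (c * h ^ (14 * r))            ≡⟨ x∙yz≈y∙xz *-commutativeSemigroup (h ^ (k * 9)) c _ ⟩
  c * (h ^ (k * 9) * h ^ (14 * r))            ≡⟨ cong (c *_) (^-distribˡ-+-* h (k * 9) (14 * r)) ⟨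
  c * h ^ (k * 9 + 14 * r)                    ≡⟨ cong (λ e → c * h ^ e) exponent ⟩
  c * h ^ (9 * (r + (r + k)) ∸ 4 * r)         ∎
  where
  open ≡-Reasoning
  exponent : k * 9 + 14 * r ≡ 9 * (r + (r + k)) ∸ 4 * r
  exponent = trans (sym (m+n∸n≡m (k * 9 + 14 * r) (4 * r))) (cong (_∸ 4 * r) (collect r k))
    where
    collect : ∀ r k → k * 9 + 14 * r + 4 * r ≡ 9 * (r + (r + k))
    collect = solve-∀

-- Counting solutions in a box.

module _ (r k K : ℕ) where

  private
    C = proj₁ (intervalDivisorBound K)
    c = 2 ^ 9 * C ^ r

  module _ (a : ℤ) (a≢0 : a ≢ ℤ.+ 0)
    (fs gs : Vec Poly r) (es : Vec Poly k) (ks ls : Vec ℕ r) (ms : Vec ℕ k)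
    (ks≢0 : VecAll NonZero ks) (ls≢0 : VecAll NonZero ls) (∑ks≤K : Vec.sum ks ≤ K) (∑ls≤K : Vec.sum ls ≤ K)
    (us vs : Vec ℤ r) (ws : Vec ℤ k) (h : ℕ) .{{_ : NonZero h}} where

    private
      sol? : (x : Vec ℕ (r + (r + k))) → Dec (Sol a (fs ++ gs ++ es) (ks ++ ls ++ ms) (boxPoint (us ++ vs ++ ws) x))
      sol? x = Sol? a (fs ++ gs ++ es) (ks ++ ls ++ ms) (boxPoint (us ++ vs ++ ws) x)

      box = offsets r h

      box-++ : ∀ i j l → boxPoint (us ++ vs ++ ws) (i ++ j ++ l) ≡ boxPoint us i ++ boxPoint vs j ++ boxPoint ws l
      box-++ i j l = trans (boxPoint-++ us (vs ++ ws) i (j ++ l)) (cong (boxPoint us i ++_) (boxPoint-++ vs ws j l))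

      p q : Vec ℕ r → ℤ
      p i = monomial ks (boxPoint us i)
      q j = monomial ls (boxPoint vs j)

    module _ (l : Vec ℕ k) where

      private
        m = monomial ms (boxPoint ws l)

        R : Vec ℕ r → Vec ℕ r → Set
        R i j = Sol a (fs ++ gs ++ es) (ks ++ ls ++ ms) (boxPoint (us ++ vs ++ ws) (i ++ j ++ l))

        nonzero : ∀ i j → R i j → p i ≢ ℤ.+ 0 × q j ≢ ℤ.+ 0 × m ≢ ℤ.+ 0
        nonzero i j (≢0 , _) with AllNonzero-++⁻ (boxPoint us i) (boxPoint vs j ++ boxPoint ws l) (subst AllNonzero (box-++ i j l) ≢0)
        ... | xs≢0 , yzs≢0 with AllNonzero-++⁻ (boxPoint vs j) (boxPoint ws l) yzs≢0
        ...   | ys≢0 , zs≢0 = monomial≢0 ks (boxPoint us i) xs≢0 , monomial≢0 ls (boxPoint vs j) ys≢0 , monomial≢0 ms (boxPoint ws l) zs≢0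

        equation : ∀ i j → R i j →
          lhs fs (boxPoint us i) ℤ.+ (lhs gs (boxPoint vs j) ℤ.+ lhs es (boxPoint ws l)) ≡ a ℤ.* (p i ℤ.* (q j ℤ.* m))
        equation i j (_ , eq) = begin
          lhs fs x ℤ.+ (lhs gs y ℤ.+ lhs es z)               ≡⟨ cong (λ s → lhs fs x ℤ.+ s) (lhs-++ gs es y z) ⟨
          lhs fs x ℤ.+ lhs (gs ++ es) (y ++ z)               ≡⟨ lhs-++ fs (gs ++ es) x (y ++ z) ⟨
          lhs (fs ++ gs ++ es) (x ++ y ++ z)                 ≡⟨ cong (lhs (fs ++ gs ++ es)) (box-++ i j l) ⟨
          lhs (fs ++ gs ++ es) X                             ≡⟨ eq ⟩
          a ℤ.* monomial (ks ++ ls ++ ms) X                  ≡⟨ cong (λ v → a ℤ.* monomial (ks ++ ls ++ ms) v) (box-++ i j l) ⟩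
          a ℤ.* monomial (ks ++ ls ++ ms) (x ++ y ++ z)      ≡⟨ cong (λ s → a ℤ.* s) (monomial-++ ks (ls ++ ms) x (y ++ z)) ⟩
          a ℤ.* (p i ℤ.* monomial (ls ++ ms) (y ++ z))       ≡⟨ cong (λ s → a ℤ.* (p i ℤ.* s)) (monomial-++ ls ms y z) ⟩
          a ℤ.* (p i ℤ.* (q j ℤ.* m))                        ∎
          where
          open ≡-Reasoning
          X = boxPoint (us ++ vs ++ ws) (i ++ j ++ l)
          x = boxPoint us i
          y = boxPoint vs j
          z = boxPoint ws l

        determined : ∀ {i i′ j j′} → p i ≢ p i′ → R i j → R i′ j → R i j′ → R i′ j′ → q j ≡ q j′
        determined {i} {i′} {j} {j′} p≢p′ R₁ R₂ R₃ R₄ =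
          lines-determine {F = lhs fs (boxPoint us i)} {lhs fs (boxPoint us i′)} {lhs gs (boxPoint vs j)} {lhs gs (boxPoint vs j′)}
            (lhs es (boxPoint ws l)) a≢0 (proj₂ (proj₂ (nonzero i j R₁))) p≢p′
            (equation i j R₁) (equation i′ j R₂) (equation i j′ R₃) (equation i′ j′ R₄)

        T-root = root 9 (C ^ r * h ^ r)
        T = proj₁ T-root
        N = ∑ box (λ i → ∑ box (λ j → χ (sol? (i ++ j ++ l))))

        -- Both blocks have h^r points, so the two terms of the incidence bound coincide; this is
        -- the origin of the factor 2.
        N²≤ : N * N ≤ h ^ r * (h ^ r * (2 * (T * h ^ r)))
        N²≤ = subst (N * N ≤_) (trans (cong (λ H → H * (H * (T * H + H * T))) (length-offsets r h)) (double (h ^ r) T))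
          (Incidences.incidences² box box (λ i j → sol? (i ++ j ++ l)) p q T
            (λ {i} {j} → proj₁ ∘ nonzero i j) (λ {i} {j} → proj₁ ∘ proj₂ ∘ nonzero i j)
            (λ {i} {i′} {j} {j′} → determined {i} {i′} {j} {j′})
            (λ Q≢0 → proj₂ (proj₂ T-root) (boxMonomialCount K ks ks≢0 ∑ks≤K us h Q≢0))
            (λ Q≢0 → proj₂ (proj₂ T-root) (boxMonomialCount K ls ls≢0 ∑ls≤K vs h Q≢0)))
          where
          double : ∀ H T → H * (H * (T * H + H * T)) ≡ H * (H * (2 * (T * H)))
          double = solve-∀

      sliceCount : ∑ box (λ i → ∑ box (λ j → χ (sol? (i ++ j ++ l)))) ^ 9 ≤ c ^ 9 * h ^ (14 * r)
      sliceCount = sliceArithmetic {N} {T} h r 2 (C ^ r) (proj₁ (proj₂ T-root)) N²≤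

    private
      Nstar≡∑ : Nstar a (fs ++ gs ++ es) (ks ++ ls ++ ms) (us ++ vs ++ ws) h ≡ ∑ (offsets (r + (r + k)) h) (λ x → χ (sol? x))
      Nstar≡∑ = length-filter-χ sol? (offsets (r + (r + k)) h)

    boxCount : Nstar a (fs ++ gs ++ es) (ks ++ ls ++ ms) (us ++ vs ++ ws) h ^ 9 ≤ c ^ 9 * h ^ (9 * (r + (r + k)) ∸ 4 * r)
    boxCount = begin
      Nstar a (fs ++ gs ++ es) (ks ++ ls ++ ms) (us ++ vs ++ ws) h ^ 9     ≡⟨ cong (_^ 9) Nstar≡∑ ⟩
      ∑ (offsets (r + (r + k)) h) (λ x → χ (sol? x)) ^ 9                   ≤⟨ ∑-slices-≤ r k h (λ x → χ (sol? x)) sliceCount ⟩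
      h ^ (k * 9) * (c ^ 9 * h ^ (14 * r))                                 ≡⟨ collectExponents h r k (c ^ 9) ⟩
      c ^ 9 * h ^ (9 * (r + (r + k)) ∸ 4 * r)                              ∎
      where open ≤-Reasoning

-- The choice of blocks and of the constant.

Vec-sum-++ : ∀ {m n} (ks : Vec ℕ m) (ls : Vec ℕ n) → Vec.sum (ks ++ ls) ≡ Vec.sum ks + Vec.sum ls
Vec-sum-++ []       ls = refl
Vec-sum-++ (k ∷ ks) ls = trans (cong (k +_) (Vec-sum-++ ks ls)) (sym (+-assoc k _ _))

odd⇒nonZero : ∀ k → k % 2 ≡ 1 → NonZero k
odd⇒nonZero (suc _) _ = _

theorem1p1 : (r : ℕ) → 1 ≤ r →
    Σ ℕ λ M → 1 ≤ M ×
    ((n d : ℕ) → 1 ≤ n → (a : ℤ) → ¬ (a ≡ ℤ.+ 0) → (ks : Vec ℕ n) →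
    ((i : Fin n) → lookup ks i % 2 ≡ 1) →
    (d + 1) * (d + 2) * 2 ^ r * ((4 * r) ⊔ (6 * r ∸ 9)) + 4 < 2 * n →
    Σ ℕ λ c →
    (fs : Vec Poly n) → ((i : Fin n) → DegLe (lookup fs i) d) →
    (u : Vec ℤ n) (h : ℕ) → 1 ≤ h →
    ((i : Fin n) → Σ ℕ λ t → (t * M) ^ 9 ≤ h ^ 4 × ∣ lookup u i ∣ ≤ 2 ^ (1 + t)) →
    Nstar a fs ks u h ^ 9 ≤ c ^ 9 * h ^ (9 * n ∸ 4 * r))
theorem1p1 r _ = 1 , ≤-refl , bound
  where
  bound : (n d : ℕ) → 1 ≤ n → (a : ℤ) → ¬ (a ≡ ℤ.+ 0) → (ks : Vec ℕ n) →
    ((i : Fin n) → lookup ks i % 2 ≡ 1) →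
    (d + 1) * (d + 2) * 2 ^ r * ((4 * r) ⊔ (6 * r ∸ 9)) + 4 < 2 * n →
    Σ ℕ λ c →
    (fs : Vec Poly n) → ((i : Fin n) → DegLe (lookup fs i) d) →
    (u : Vec ℤ n) (h : ℕ) → 1 ≤ h →
    ((i : Fin n) → Σ ℕ λ t → (t * 1) ^ 9 ≤ h ^ 4 × ∣ lookup u i ∣ ≤ 2 ^ (1 + t)) →
    Nstar a fs ks u h ^ 9 ≤ c ^ 9 * h ^ (9 * n ∸ 4 * r)
  bound n d _ a a≢0 ks odd large with r+[r+k]≡n
    where
    open ≤-Reasoning
    E = (d + 1) * (d + 2) * 2 ^ r
    -- The lower bound on `n` leaves room for two blocks of `r` variables, since 4r is one of the
    -- terms of the maximum.
    2r≤n : r + r ≤ n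
    2r≤n = *-cancelˡ-≤ 2 (begin
      2 * (r + r)                                ≡⟨ 4r r ⟩
      4 * r                                      ≤⟨ m≤m⊔n (4 * r) (6 * r ∸ 9) ⟩
      4 * r ⊔ (6 * r ∸ 9)                        ≤⟨ m≤n*m _ E {{E≢0}} ⟩
      E * (4 * r ⊔ (6 * r ∸ 9))                  ≤⟨ m≤m+n _ 4 ⟩
      E * (4 * r ⊔ (6 * r ∸ 9)) + 4              ≤⟨ <⇒≤ large ⟩
      2 * n                                      ∎)
      where
      4r : ∀ r → 2 * (r + r) ≡ 4 * r
      4r = solve-∀
      E≢0 : NonZero E
      E≢0 = m*n≢0 _ _ {{m*n≢0 _ _ {{>-nonZero (m≤n+m 1 d)}} {{>-nonZero (≤-trans (n≤1+n 1) (m≤n+m 2 d))}}}} {{m^n≢0 2 r}}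
    r+[r+k]≡n : ∃[ k ] r + (r + k) ≡ n
    r+[r+k]≡n with m≤n⇒∃[o]m+o≡n 2r≤n
    ... | k , 2r+k≡n = k , trans (sym (+-assoc r r k)) 2r+k≡n
  ... | k , refl with Vec.splitAt r ks
  ...   | ks₁ , ks₂₃ , refl with Vec.splitAt r ks₂₃
  ...     | ks₂ , ks₃ , refl = c , count
    where
    -- The total degree bounds the degree of each block. The constant below is thus determined by
    -- `r` and the exponents, before the polynomials and the box are given.
    K = Vec.sum (ks₁ ++ ks₂ ++ ks₃)
    c = 2 ^ 9 * proj₁ (intervalDivisorBound K) ^ r
    -- Odd exponents are positive, which makes every coordinate a divisor of its monomial.
    ks≢0 : VecAll NonZero (ks₁ ++ ks₂ ++ ks₃)
    ks≢0 = VecAll.lookup⁻ (λ i → odd⇒nonZero _ (odd i))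
    ks₂≢0 : VecAll NonZero ks₂
    ks₂≢0 = VecAll.++ˡ⁻ ks₂ (VecAll.++ʳ⁻ ks₁ ks≢0)
    ∑ks₁≤K : Vec.sum ks₁ ≤ K
    ∑ks₁≤K = subst (_ ≤_) (sym (Vec-sum-++ ks₁ _)) (m≤m+n _ _)
    ∑ks₂≤K : Vec.sum ks₂ ≤ K
    ∑ks₂≤K = subst (_ ≤_) (sym (trans (Vec-sum-++ ks₁ _) (cong (Vec.sum ks₁ +_) (Vec-sum-++ ks₂ ks₃))))
      (≤-trans (m≤m+n _ (Vec.sum ks₃)) (m≤n+m _ (Vec.sum ks₁)))
    count : (fs : Vec Poly (r + (r + k))) → _ → (us : Vec ℤ (r + (r + k))) (h : ℕ) → 1 ≤ h → _ →
      Nstar a fs (ks₁ ++ ks₂ ++ ks₃) us h ^ 9 ≤ c ^ 9 * h ^ (9 * (r + (r + k)) ∸ 4 * r)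
    count fs _ us h 1≤h _ with Vec.splitAt r fs | Vec.splitAt r us
    ... | fs₁ , fs₂₃ , refl | us₁ , us₂₃ , refl with Vec.splitAt r fs₂₃ | Vec.splitAt r us₂₃
    ...   | fs₂ , fs₃ , refl | us₂ , us₃ , refl = boxCount r k K a a≢0 fs₁ fs₂ fs₃ ks₁ ks₂ ks₃
      (VecAll.++ˡ⁻ ks₁ ks≢0) ks₂≢0 ∑ks₁≤K ∑ks₂≤K us₁ us₂ us₃ h {{>-nonZero 1≤h}}
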